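{- For an arbitrary snark $G$, the following statements are equivalent: (i) $G$ is bicritical; (ii) $G$ is $4$-vertex-critical; (iii) $G$ is $7$-irreducible; (iv) $G$ is irreducible.
   Context: Graphs may have parallel edges and loops. A snark is a connected cubic graph that admits no proper edge-colouring with three colours (equivalently, no nowhere-zero $4$-flow). For distinct vertices $u,v$ of $G$, $G-\{u,v\}$ denotes the graph obtained by removing $u$ and $v$ but retaining the edges formerly incident with them as dangling edges, and $G/\{u,v\}$ denotes the graph obtained by identifying $u$ and $v$. A snark $G$ is bicritical if $G-\{u,v\}$ is $3$-edge-colourable for every pair of distinct vertices $u,v$. A snark $G$ is $4$-vertex-critical if $G/\{u,v\}$ admits a nowhere-zero $4$-flow for every pair of distinct vertices $u,v$. For an integer $k\ge1$, a snark $G$ is $k$-irreducible if removing fewer than $k$ edges from $G$ never produces a component of chromatic index $4$ that can be completed (by adding vertices and edges) to a cubic graph $H$ with fewer vertices than $G$; $G$ is irreducible if it is $k$-irreducible for every $k\ge1$. -}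

module Defs where

open import Data.Nat using (ℕ; zero; suc; _+_; _<_; _≤_)
open import Data.Fin using (Fin; zero; suc; punchOut)
open import Data.Fin.Properties using () renaming (_≟_ to _≟ᶠ_)
open import Data.Maybe using (Maybe; just; nothing; map)
open import Data.Maybe.Properties using (≡-dec)
open import Data.Bool using (Bool; true; false; if_then_else_)
open import Data.Integer as ℤ using (ℤ; ∣_∣)
open import Data.Product using (Σ; Σ-syntax; _×_; _,_)
open import Data.Sum using (_⊎_)
open import Relation.Nullary using (¬_; Dec; yes; no)
open import Relation.Nullary.Decidable using (⌊_⌋)
open import Relation.Binary.PropositionalEquality using (_≡_; _≢_; sym)
open import Relation.Binary.Construct.Closure.ReflexiveTransitive using (Star)

-- Graphs with parallel edges, loops and dangling edges (multipoles).
-- Vertices are Fin nV, edges are Fin nE; every edge has two ends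
-- (Fin 2), each end is either attached to a vertex (just v) or free
-- (nothing).  A loop has both ends at the same vertex; a dangling
-- edge has one free end; an isolated edge has two free ends.
-- A "graph" in the ordinary sense is one with no free ends (IsGraph).

record Graph : Set where
  constructor mkGraph
  field
    nV  : ℕ
    nE  : ℕ
    end : Fin nE → Fin 2 → Maybe (Fin nV)
open Graph public

sumℕ : ∀ {m} → (Fin m → ℕ) → ℕ
sumℕ {zero}  f = 0
sumℕ {suc m} f = f zero + sumℕ (λ i → f (suc i))

sumℤ : ∀ {m} → (Fin m → ℤ) → ℤ
sumℤ {zero}  f = ℤ.0ℤ
sumℤ {suc m} f = f zero ℤ.+ sumℤ (λ i → f (suc i))

_≟ᵐ_ : ∀ {n} (x y : Maybe (Fin n)) → Dec (x ≡ y)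
_≟ᵐ_ = ≡-dec _≟ᶠ_

swap2 : Fin 2 → Fin 2
swap2 zero = suc zero
swap2 (suc _) = zero

IsGraph : Graph → Set
IsGraph G = ∀ e i → Σ[ v ∈ Fin (nV G) ] end G e i ≡ just v

-- degree: number of edge-ends at v (a loop counts twice)
deg : (G : Graph) → Fin (nV G) → ℕ
deg G v = sumℕ λ e → sumℕ λ i → if ⌊ end G e i ≟ᵐ just v ⌋ then 1 else 0

Cubic : Graph → Set
Cubic G = IsGraph G × (∀ v → deg G v ≡ 3)

Adj : (G : Graph) → Fin (nV G) → Fin (nV G) → Set
Adj G u v = Σ[ e ∈ Fin (nE G) ]
  ((end G e zero ≡ just u × end G e (suc zero) ≡ just v)
   ⊎ (end G e zero ≡ just v × end G e (suc zero) ≡ just u))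

Connected : Graph → Set
Connected G = ∀ u v → Star (Adj G) u v

-- proper 3-edge-colouring: distinct edge-ends meeting at a vertex get
-- distinct colours (so a loop prevents colourability); free ends impose
-- no constraint.
Colourable : Graph → Set
Colourable G = Σ[ c ∈ (Fin (nE G) → Fin 3) ]
  (∀ v e i e′ i′ → (e , i) ≢ (e′ , i′) →
     end G e i ≡ just v → end G e′ i′ ≡ just v → c e ≢ c e′)

Snark : Graph → Set
Snark G = Cubic G × Connected G × ¬ Colourable G

-- G - {u,v}: delete the vertices, keep incident edges as dangling edges.

delEnd : ∀ {k} → Fin (suc k) → Maybe (Fin (suc k)) → Maybe (Fin k)
delEnd u nothing = nothing
delEnd u (just w) with w ≟ᶠ u
... | yes _ = nothing
... | no w≢u = just (punchOut {i = u} {j = w} (λ eq → w≢u (sym eq)))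

delete1 : (G : Graph) → Fin (nV G) → Graph
delete1 (mkGraph zero m end) ()
delete1 (mkGraph (suc k) m end) u = mkGraph k m (λ e i → delEnd u (end e i))

remove2 : (G : Graph) (u v : Fin (nV G)) → u ≢ v → Graph
remove2 (mkGraph zero m end) () v ne
remove2 (mkGraph (suc k) m end) u v ne =
  delete1 (mkGraph k m (λ e i → delEnd u (end e i))) (punchOut {i = u} {j = v} ne)

mergeV : ∀ {k} (u v : Fin (suc k)) → u ≢ v → Fin (suc k) → Fin k
mergeV u v ne w with w ≟ᶠ v
... | yes _   = punchOut {i = v} {j = u} (λ eq → ne (sym eq))
... | no w≢v = punchOut {i = v} {j = w} (λ eq → w≢v (sym eq))

identify : (G : Graph) (u v : Fin (nV G)) → u ≢ v → Graph
identify (mkGraph zero m end) () v ne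
identify (mkGraph (suc k) m end) u v ne =
  mkGraph k m (λ e i → map (mergeV u v ne) (end e i))

-- Nowhere-zero 4-flow: an orientation o (o e = true reverses the
-- edge) and integer values with 1 ≤ |f e| ≤ 3, with Kirchhoff's law at
-- every vertex (inflow = outflow).

headE : (G : Graph) → (Fin (nE G) → Bool) → Fin (nE G) → Maybe (Fin (nV G))
headE G o e = if o e then end G e zero else end G e (suc zero)

tailE : (G : Graph) → (Fin (nE G) → Bool) → Fin (nE G) → Maybe (Fin (nV G))
tailE G o e = if o e then end G e (suc zero) else end G e zero

HasNZ4Flow : Graph → Set
HasNZ4Flow G = Σ[ o ∈ (Fin (nE G) → Bool) ] Σ[ f ∈ (Fin (nE G) → ℤ) ]
  ((∀ e → 1 ≤ ∣ f e ∣ × ∣ f e ∣ ≤ 3) ×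
   (∀ v → sumℤ (λ e → (if ⌊ headE G o e ≟ᵐ just v ⌋ then f e else ℤ.0ℤ)
                   ℤ.- (if ⌊ tailE G o e ≟ᵐ just v ⌋ then f e else ℤ.0ℤ))
          ≡ ℤ.0ℤ))

Bicritical : Graph → Set
Bicritical G = ∀ u v → (ne : u ≢ v) → Colourable (remove2 G u v ne)

FourVertexCritical : Graph → Set
FourVertexCritical G = ∀ u v → (ne : u ≢ v) → HasNZ4Flow (identify G u v ne)

-- Irreducibility.  F ⊆ E(G) is the set of removed edges; each removed
-- edge is split into two dangling edges, one at each former end.  A
-- component of the result is given by its vertex set S ⊆ V(G).

count : ∀ {m} → (Fin m → Bool) → ℕ
count F = sumℕ (λ e → if F e then 1 else 0)

module _ (G : Graph) (F : Fin (nE G) → Bool) (S : Fin (nV G) → Bool) where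

  AdjOff : Fin (nV G) → Fin (nV G) → Set
  AdjOff u v = Σ[ e ∈ Fin (nE G) ] F e ≡ false ×
    ((end G e zero ≡ just u × end G e (suc zero) ≡ just v)
     ⊎ (end G e zero ≡ just v × end G e (suc zero) ≡ just u))

  Component : Set
  Component =
    (Σ[ v ∈ Fin (nV G) ] S v ≡ true) ×
    (∀ e u v → F e ≡ false → end G e zero ≡ just u →
       end G e (suc zero) ≡ just v → S u ≡ S v) ×
    (∀ u v → S u ≡ true → S v ≡ true → Star AdjOff u v)

  -- the component (with the dangling halves of removed edges) is
  -- 3-edge-colourable: colours are given per edge-end; the two ends of
  -- a non-removed edge carry the same colour, the two halves of a
  -- removed edge are independent; properness at vertices of S.
  ComponentColourable : Set
  ComponentColourable = Σ[ c ∈ (Fin (nE G) → Fin 2 → Fin 3) ]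
    ((∀ e → F e ≡ false → c e zero ≡ c e (suc zero)) ×
     (∀ v → S v ≡ true → ∀ e i e′ i′ → (e , i) ≢ (e′ , i′) →
        end G e i ≡ just v → end G e′ i′ ≡ just v → c e i ≢ c e′ i′))

  Internal : Fin (nE G) → Set
  Internal e = F e ≡ false ×
    (∀ i → Σ[ v ∈ Fin (nV G) ] end G e i ≡ just v × S v ≡ true)

  -- the component can be completed, by adding vertices and edges, to a
  -- cubic graph H with fewer vertices than G: its vertices and internal
  -- edges embed injectively into H preserving incidences (the dangling
  -- edges are then completed by the remaining edge-ends of H).
  CompletableToSmaller : Set
  CompletableToSmaller = Σ[ H ∈ Graph ] Cubic H × nV H < nV G ×
    Σ[ φ ∈ (Fin (nV G) → Fin (nV H)) ] Σ[ ψ ∈ (Fin (nE G) → Fin (nE H)) ]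
      ((∀ u v → S u ≡ true → S v ≡ true → φ u ≡ φ v → u ≡ v) ×
       (∀ e e′ → Internal e → Internal e′ → ψ e ≡ ψ e′ → e ≡ e′) ×
       (∀ e → Internal e →
          (∀ i → end H (ψ e) i ≡ map φ (end G e i))
          ⊎ (∀ i → end H (ψ e) i ≡ map φ (end G e (swap2 i)))))

KIrreducible : ℕ → Graph → Set
KIrreducible k G = ∀ (F : Fin (nE G) → Bool) → count F < k →
  ∀ (S : Fin (nV G) → Bool) → Component G F S →
  ¬ ComponentColourable G F S → ¬ CompletableToSmaller G F S

Irreducible : Graph → Set
Irreducible G = ∀ k → 1 ≤ k → KIrreducible k G

{-# OPTIONS --safe #-}

-- A nowhere-zero 4-flow is the same as a nowhere-zero ℤ₂ × ℤ₂-flow: a set of edges that is even at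
-- every vertex decomposes into closed trails, and walking along these turns it into an integer flow
-- with values ±1; so two even sets a, b that cover all edges give the flow a + 2b, and conversely f
-- and (f + y) / 2 do, where y is the ±1-flow on the odd edges of f.  The three nonzero elements of
-- ℤ₂ × ℤ₂ are the colours, and at a vertex of degree 3 Kirchhoff's law says that the colours are
-- distinct.  Hence a colouring of G − {u, v} is a flow on G / {u, v}; the law at the merged vertex
-- follows from the others.
--
-- If a component S embeds into a smaller cubic graph, then by parity at least two vertices lie
-- outside S, and a colouring of G without these two restricts to S.  Conversely, if G − {u, v}
-- is uncolourable, then so is one of its components.  It is cut off by the at most six edges at u
-- and v, and adding edges to G − {u, v} until all degrees are 3 embeds it into a cubic graph with
-- two vertices fewer than G.

module Submission where

open import Defs
open import Algebra.Bundles using (CommutativeMonoid)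
open import Algebra.Morphism.Structures using (IsMonoidHomomorphism)
import Algebra.Properties.CommutativeMonoid.Sum as Sum
import Algebra.Properties.CommutativeSemigroup as CommutativeSemigroupProperties
open import Data.Bool using (Bool; true; false; if_then_else_)
open import Data.Bool.Properties using (T-≡; T-not-≡; if-float; ¬-not) renaming (_≟_ to _≟ᵇ_)
open import Data.Fin using (Fin; zero; suc; punchIn; punchOut; splitAt; _↑ˡ_; finToFun; funToFin)
open import Data.Fin.Patterns using (0F; 1F; 2F)
open import Data.Fin.Properties
  using (any?; all?; ¬∀⟶∃¬; sequence; injective⇒≤; ↑ˡ-injective; punchIn-injective; punchInᵢ≢i;
    punchIn-punchOut; punchOut-cong; punchOut-injective; punchOut-punchIn; finToFun-funToFin)
  renaming (_≟_ to _≟ᶠ_)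
open import Data.Integer using (ℤ; ∣_∣; 0ℤ; 1ℤ; -1ℤ; -[1+_]; _⊖_)
  renaming (+_ to nonneg; _+_ to _+ᶻ_; _-_ to _-ᶻ_; -_ to -ᶻ_)
import Data.Integer.Properties as ℤₚ
open import Data.Integer.Tactic.RingSolver using (solve-∀)
open import Data.List as List
  using (List; []; _∷_; length; filter; tabulate; cartesianProduct; allFin; lookup)
open import Data.List.Membership.Propositional using (_∈_)
open import Data.List.Membership.Propositional.Properties
  using (∈-filter⁺; ∈-filter⁻; ∈-map⁺; ∈-map⁻; ∈-lookup; ∈-cartesianProduct⁺; ∈-allFin)
open import Data.List.Relation.Unary.All as All using ()
open import Data.List.Relation.Unary.AllPairs using (_∷_)
open import Data.List.Relation.Unary.Any using (here; there; index)
open import Data.List.Relation.Unary.Any.Properties using (lookup-index)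
open import Data.List.Relation.Unary.Unique.Propositional using (Unique)
import Data.List.Relation.Unary.Unique.Propositional.Properties as Unique
open import Data.Maybe using (Maybe; just; nothing; map; fromMaybe)
open import Data.Maybe.Properties using (just-injective)
open import Data.Nat using (ℕ; zero; suc; parity; _+_; _∸_; _≤_; _<_; z≤n; s≤s)
import Data.Nat.Properties as ℕₚ
open import Data.Parity using (Parity; 0ℙ; 1ℙ) renaming (_+_ to _+ᵖ_)
import Data.Parity.Properties as ℙₚ
open import Data.Product using (Σ-syntax; ∃; _×_; _,_; proj₁; proj₂; uncurry)
open import Data.Product.Properties using () renaming (≡-dec to ×-≡-dec)
open import Data.Sum using (_⊎_; inj₁; inj₂)
open import Data.Sum.Properties using ([,]-map)
open import Data.Vec.Functional using (removeAt; insertAt; _++_) renaming (_∷_ to _∷ᵛ_)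
open import Data.Vec.Functional.Properties using (insertAt-lookup; insertAt-punchIn; lookup-++ˡ)
open import Effect.Monad using (RawMonad)
open import Function using (_∘_; const; id; case_of_)
open import Function.Bundles using (_⇔_; mk⇔; module Equivalence)
open import Function.Construct.Composition using (_⇔-∘_)
open import Function.Construct.Symmetry using (⇔-sym)
open import Function.Definitions using (Injective)
open import Level using (0ℓ)
open import Relation.Binary.Construct.Closure.Equivalence as EqClosure using (EqClosure)
open import Relation.Binary.Construct.Closure.ReflexiveTransitive as Star using (Star; _◅_; _◅◅_)
open import Relation.Binary.Construct.Closure.Symmetric using (SymClosure; fwd; bwd)
open import Relation.Binary.Definitions using (DecidableEquality)
open import Relation.Binary.PropositionalEquality
  using (_≡_; _≢_; _≗_; refl; sym; trans; cong; cong₂; subst; module ≡-Reasoning)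
import Relation.Binary.Reasoning.Setoid as ≈-Reasoning
open import Relation.Nullary using (¬_; Dec; yes; no; contradiction; _×-dec_; _→-dec_; ¬?)
open import Relation.Nullary.Decidable
  using (⌊_⌋; toWitness; fromWitness; toWitnessFalse; fromWitnessFalse; from-yes; map′;
    decidable-stable)
open import Relation.Nullary.Negation using (¬¬-map; ¬¬-Monad)
open import Relation.Unary using (Pred; Decidable)

open Equivalence using (to; from)

private variable
  k m n : ℕ
  A B : Set

-- Finite maps and lists

module _ {P : (Fin m → Fin n) → Set} (resp : ∀ {f g} → f ≗ g → P f → P g) (P? : Decidable P) where

  any-map? : Dec (∃ P)
  any-map? = map′ (λ (i , p) → finToFun i , p)
    (λ (f , p) → funToFin f , resp (sym ∘ finToFun-funToFin f) p) (any? (P? ∘ finToFun))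

  all-maps? : Dec (∀ f → P f)
  all-maps? = map′ (λ all f → resp (finToFun-funToFin f) (all (funToFin f)))
    (λ all i → all (finToFun i)) (all? (P? ∘ finToFun))

punchIn-cases : {P : Fin (suc n) → Set} (j : Fin (suc n)) →
  P j → (∀ i → P (punchIn j i)) → ∀ i → P i
punchIn-cases {P = P} j at-j off-j i with j ≟ᶠ i
... | yes refl = at-j
... | no j≢i   = subst P (punchIn-punchOut j≢i) (off-j (punchOut j≢i))

lookup-injective : {xs : List A} → Unique xs → Injective _≡_ _≡_ (lookup xs)
lookup-injective (x∉ ∷ xs!) {zero}  {zero}  _  = refl
lookup-injective (x∉ ∷ xs!) {zero}  {suc j} eq = contradiction eq (All.lookup x∉ (∈-lookup j))
lookup-injective (x∉ ∷ xs!) {suc i} {zero}  eq = contradiction (sym eq) (All.lookup x∉ (∈-lookup i))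
lookup-injective (x∉ ∷ xs!) {suc i} {suc j} eq = cong suc (lookup-injective xs! eq)

-- Finite sums

module FiniteSum (M : CommutativeMonoid 0ℓ 0ℓ) where

  open CommutativeMonoid M renaming (refl to ≈-refl; sym to ≈-sym; trans to ≈-trans)
  open Sum M public
  open ≈-Reasoning setoid

  sum-zero : {f : Fin n → Carrier} → (∀ i → f i ≈ ε) → sum f ≈ ε
  sum-zero {n} f≈ε = ≈-trans (sum-cong-≋ f≈ε) (sum-replicate-zero n)

  sum-single : (f : Fin n → Carrier) (i : Fin n) → (∀ j → j ≢ i → f j ≈ ε) → sum f ≈ f i
  sum-single {suc n} f i elsewhere = begin
    sum f                      ≈⟨ sum-remove f ⟩
    f i ∙ sum (removeAt f i)   ≈⟨ ∙-congˡ (sum-zero λ j → elsewhere _ (punchInᵢ≢i i j)) ⟩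
    f i ∙ ε                    ≈⟨ identityʳ (f i) ⟩
    f i                        ∎

  sum-++ : (f : A → Carrier) (xs : Fin m → A) (ys : Fin n → A) →
    sum (f ∘ (xs ++ ys)) ≈ sum (f ∘ xs) ∙ sum (f ∘ ys)
  sum-++ {m = zero}  f xs ys = ≈-sym (identityˡ _)
  sum-++ {m = suc m} f xs ys = begin
    f (xs zero) ∙ sum (f ∘ (xs ++ ys) ∘ suc)
      ≡⟨ cong (f (xs zero) ∙_) (sum-cong-≗ λ i → cong f ([,]-map (splitAt m i))) ⟩
    f (xs zero) ∙ sum (f ∘ (xs ∘ suc ++ ys))
      ≈⟨ ∙-congˡ (sum-++ f (xs ∘ suc) ys) ⟩
    f (xs zero) ∙ (sum (f ∘ xs ∘ suc) ∙ sum (f ∘ ys))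
      ≈⟨ assoc _ _ _ ⟨
    sum (f ∘ xs) ∙ sum (f ∘ ys) ∎

  sumOver : List A → (A → Carrier) → Carrier
  sumOver xs f = sum (f ∘ lookup xs)

  sumOver-++ : (xs ys : List A) (f : A → Carrier) →
    sumOver (xs List.++ ys) f ≈ sumOver xs f ∙ sumOver ys f
  sumOver-++ []       ys f = ≈-sym (identityˡ _)
  sumOver-++ (x ∷ xs) ys f = ≈-trans (∙-congˡ (sumOver-++ xs ys f)) (≈-sym (assoc _ _ _))

  sumOver-map : (h : A → B) (xs : List A) (f : B → Carrier) →
    sumOver (List.map h xs) f ≈ sumOver xs (f ∘ h)
  sumOver-map h []       f = ≈-refl
  sumOver-map h (x ∷ xs) f = ∙-congˡ (sumOver-map h xs f)

  sumOver-tabulate : (h : Fin n → A) (f : A → Carrier) → sumOver (tabulate h) f ≈ sum (f ∘ h)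
  sumOver-tabulate {zero}  h f = ≈-refl
  sumOver-tabulate {suc n} h f = ∙-congˡ (sumOver-tabulate (h ∘ suc) f)

  sumOver-cartesianProduct : (xs : List A) (ys : List B) (f : A × B → Carrier) →
    sumOver (cartesianProduct xs ys) f ≈ sumOver xs λ x → sumOver ys λ y → f (x , y)
  sumOver-cartesianProduct []       ys f = ≈-refl
  sumOver-cartesianProduct (x ∷ xs) ys f =
    ≈-trans (sumOver-++ (List.map (x ,_) ys) (cartesianProduct xs ys) f)
      (∙-cong (sumOver-map (x ,_) ys f) (sumOver-cartesianProduct xs ys f))

  sumOver-filter : {P : Pred A 0ℓ} (P? : Decidable P) (xs : List A) (f : A → Carrier) →
    sumOver (filter P? xs) f ≈ sumOver xs λ x → if ⌊ P? x ⌋ then f x else ε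
  sumOver-filter P? []       f = ≈-refl
  sumOver-filter P? (x ∷ xs) f with P? x
  ... | yes _ = ∙-congˡ (sumOver-filter P? xs f)
  ... | no _  = ≈-trans (sumOver-filter P? xs f) (≈-sym (identityˡ _))

-- Edge-ends and their sums

Site : ℕ → Set
Site n = Maybe (Fin n)

Ends : ℕ → ℕ → Set
Ends m n = Fin m → Fin 2 → Site n

Closed : Ends m n → Set
Closed {n = n} E = ∀ e i → Σ[ v ∈ Fin n ] E e i ≡ just v

module _ {E : Ends m n} (closed : Closed E) where

  endpoint : Fin m → Fin 2 → Fin n
  endpoint e i = proj₁ (closed e i)

  at-endpoint : ∀ e i → E e i ≡ just (endpoint e i)
  at-endpoint e i = proj₂ (closed e i)

  endpoint-unique : ∀ {e i v} → E e i ≡ just v → endpoint e i ≡ v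
  endpoint-unique {e} {i} at-v = just-injective (trans (sym (at-endpoint e i)) at-v)

allEnds : ∀ m → List (Fin m × Fin 2)
allEnds m = cartesianProduct (allFin m) (allFin 2)

module EndsAt (E : Ends m n) (w : Site n) where

  attached? : Decidable {A = Fin m × Fin 2} λ (e , i) → E e i ≡ w
  attached? (e , i) = E e i ≟ᵐ w

  endsAt : List (Fin m × Fin 2)
  endsAt = filter attached? (allEnds m)

  ∈-endsAt : ∀ e i → (e , i) ∈ endsAt ⇔ E e i ≡ w
  ∈-endsAt e i = mk⇔ (proj₂ ∘ ∈-filter⁻ attached? {xs = allEnds m})
    (∈-filter⁺ attached? (∈-cartesianProduct⁺ (∈-allFin e) (∈-allFin i)))

  endsAt-unique : Unique endsAt
  endsAt-unique =
    Unique.filter⁺ attached? (Unique.cartesianProduct⁺ (Unique.allFin⁺ m) (Unique.allFin⁺ 2))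

module EndSum (M : CommutativeMonoid 0ℓ 0ℓ) where

  open CommutativeMonoid M renaming (refl to ≈-refl; sym to ≈-sym; trans to ≈-trans)
  open FiniteSum M public
  open ≈-Reasoning setoid

  mass : Site n → Carrier → Site n → Carrier
  mass x c w = if ⌊ x ≟ᵐ w ⌋ then c else ε

  mass-≡ : {x w : Site n} (c : Carrier) → x ≡ w → mass x c w ≡ c
  mass-≡ {x = x} {w} c x≡w with x ≟ᵐ w
  ... | yes _  = refl
  ... | no x≢w = contradiction x≡w x≢w

  mass-≢ : {x w : Site n} (c : Carrier) → x ≢ w → mass x c w ≡ ε
  mass-≢ {x = x} {w} c x≢w with x ≟ᵐ w
  ... | yes x≡w = contradiction x≡w x≢w
  ... | no _    = refl

  mass-ε : (x w : Site n) → mass x ε w ≡ ε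
  mass-ε x w with x ≟ᵐ w
  ... | yes _ = refl
  ... | no _  = refl

  mass-∙ : (x : Site n) (c d : Carrier) (w : Site n) →
    mass x (c ∙ d) w ≈ mass x c w ∙ mass x d w
  mass-∙ x c d w with x ≟ᵐ w
  ... | yes _ = ≈-refl
  ... | no _  = ≈-sym (identityˡ ε)

  mass-cong-⇔ : {x w : Site n} {y z : Site k} (c : Carrier) →
    x ≡ w ⇔ y ≡ z → mass x c w ≡ mass y c z
  mass-cong-⇔ {x = x} {w} c x≡w⇔y≡z with x ≟ᵐ w
  ... | yes x≡w = sym (mass-≡ c (to x≡w⇔y≡z x≡w))
  ... | no x≢w  = sym (mass-≢ c (x≢w ∘ from x≡w⇔y≡z))

  sum-mass : (a : Fin n) (c : Carrier) → sum (λ v → mass (just a) c (just v)) ≈ c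
  sum-mass a c = ≈-trans
    (sum-single (λ v → mass (just a) c (just v)) a λ v v≢a →
      reflexive (mass-≢ c λ a≡v → v≢a (sym (just-injective a≡v))))
    (reflexive (mass-≡ {x = just a} c refl))

  edgeSum : Ends m n → (Fin m → Fin 2 → Carrier) → Site n → Fin m → Carrier
  edgeSum E g w e = sum λ i → mass (E e i) (g e i) w

  endSum : Ends m n → (Fin m → Fin 2 → Carrier) → Site n → Carrier
  endSum E g w = sum (edgeSum E g w)

  endSum-cong : (E : Ends m n) {g h : Fin m → Fin 2 → Carrier} (w : Site n) →
    (∀ e i → g e i ≡ h e i) → endSum E g w ≡ endSum E h w
  endSum-cong E w g≡h =
    sum-cong-≗ λ e → sum-cong-≗ λ i → cong (λ c → mass (E e i) c w) (g≡h e i)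

  endSum-endsAt : (E : Ends m n) (g : Fin m → Fin 2 → Carrier) (w : Site n) →
    endSum E g w ≈ sumOver (EndsAt.endsAt E w) (uncurry g)
  endSum-endsAt {m} E g w = begin
    endSum E g w
      ≈⟨ sumOver-tabulate id (edgeSum E g w) ⟨
    sumOver (allFin m) (edgeSum E g w)
      ≈⟨ sumOver-cartesianProduct (allFin m) (allFin 2) massAt ⟨
    sumOver (allEnds m) massAt
      ≈⟨ sumOver-filter (EndsAt.attached? E w) (allEnds m) (uncurry g) ⟨
    sumOver (EndsAt.endsAt E w) (uncurry g) ∎
    where
    massAt : Fin m × Fin 2 → Carrier
    massAt (e , i) = mass (E e i) (g e i) w

  endSum-∙ : (E : Ends m n) (g h : Fin m → Fin 2 → Carrier) (w : Site n) →
    endSum E (λ e i → g e i ∙ h e i) w ≈ endSum E g w ∙ endSum E h w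
  endSum-∙ E g h w = begin
    endSum E (λ e i → g e i ∙ h e i) w
      ≈⟨ sum-cong-≋ (λ e → sum-cong-≋ λ i → mass-∙ (E e i) (g e i) (h e i) w) ⟩
    sum (λ e → sum λ i → mass (E e i) (g e i) w ∙ mass (E e i) (h e i) w)
      ≈⟨ sum-cong-≋ (λ e →
           ∑-distrib-+ (λ i → mass (E e i) (g e i) w) (λ i → mass (E e i) (h e i) w)) ⟩
    sum (λ e → edgeSum E g w e ∙ edgeSum E h w e)
      ≈⟨ ∑-distrib-+ (edgeSum E g w) (edgeSum E h w) ⟩
    endSum E g w ∙ endSum E h w ∎

  endSum-relabel : (E : Ends m n) (E′ : Ends m k) (g : Fin m → Fin 2 → Carrier)
    {w : Site n} {w′ : Site k} →
    (∀ e i → E e i ≡ w ⇔ E′ e i ≡ w′) → endSum E g w ≡ endSum E′ g w′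
  endSum-relabel E E′ g same =
    sum-cong-≗ λ e → sum-cong-≗ λ i → mass-cong-⇔ (g e i) (same e i)

  endSum-total : (E : Ends m n) → Closed E → (g : Fin m → Fin 2 → Carrier) →
    sum (λ v → endSum E g (just v)) ≈ sum λ e → sum λ i → g e i
  endSum-total E closed g = begin
    sum (λ v → endSum E g (just v))
      ≈⟨ ∑-comm (λ v → edgeSum E g (just v)) ⟩
    sum (λ e → sum λ v → edgeSum E g (just v) e)
      ≈⟨ sum-cong-≋ (λ e → ∑-comm λ v i → mass (E e i) (g e i) (just v)) ⟩
    sum (λ e → sum λ i → sum λ v → mass (E e i) (g e i) (just v))
      ≈⟨ sum-cong-≋ (λ e → sum-cong-≋ λ i → all-at e i) ⟩
    sum (λ e → sum λ i → g e i) ∎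
    where
    all-at : ∀ e i → sum (λ v → mass (E e i) (g e i) (just v)) ≈ g e i
    all-at e i rewrite at-endpoint closed e i = sum-mass (endpoint closed e i) (g e i)

  endSum-nothing : (E : Ends m n) → Closed E → (g : Fin m → Fin 2 → Carrier) →
    endSum E g nothing ≈ ε
  endSum-nothing E closed g =
    sum-zero λ e → sum-zero λ i → reflexive (mass-≢ (g e i) (not-free e i))
    where
    not-free : ∀ e i → E e i ≢ nothing
    not-free e i free = contradiction (trans (sym (at-endpoint closed e i)) free) λ ()

module EndSumHomomorphism (M N : CommutativeMonoid 0ℓ 0ℓ)
  {⟦_⟧ : CommutativeMonoid.Carrier M → CommutativeMonoid.Carrier N}
  (homomorphism : IsMonoidHomomorphism
    (CommutativeMonoid.rawMonoid M) (CommutativeMonoid.rawMonoid N) ⟦_⟧) where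

  private
    module M = CommutativeMonoid M
    module N = CommutativeMonoid N
    module M-Sum = EndSum M
    module N-Sum = EndSum N
  open IsMonoidHomomorphism homomorphism

  sum-homo : (f : Fin n → M.Carrier) → ⟦ M-Sum.sum f ⟧ N.≈ N-Sum.sum (⟦_⟧ ∘ f)
  sum-homo {zero}  f = ε-homo
  sum-homo {suc n} f = N.trans (homo _ _) (N.∙-congˡ (sum-homo (f ∘ suc)))

  mass-homo : (x : Site n) (c : M.Carrier) (w : Site n) →
    ⟦ M-Sum.mass x c w ⟧ N.≈ N-Sum.mass x ⟦ c ⟧ w
  mass-homo x c w with x ≟ᵐ w
  ... | yes _ = N.refl
  ... | no _  = ε-homo

  edgeSum-homo : (E : Ends m n) (g : Fin m → Fin 2 → M.Carrier) (w : Site n) (e : Fin m) →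
    ⟦ M-Sum.edgeSum E g w e ⟧ N.≈ N-Sum.edgeSum E (λ e i → ⟦ g e i ⟧) w e
  edgeSum-homo E g w e = N.trans (sum-homo λ i → M-Sum.mass (E e i) (g e i) w)
    (N-Sum.sum-cong-≋ λ i → mass-homo (E e i) (g e i) w)

  endSum-homo : (E : Ends m n) (g : Fin m → Fin 2 → M.Carrier) (w : Site n) →
    ⟦ M-Sum.endSum E g w ⟧ N.≈ N-Sum.endSum E (λ e i → ⟦ g e i ⟧) w
  endSum-homo E g w =
    N.trans (sum-homo (M-Sum.edgeSum E g w)) (N-Sum.sum-cong-≋ (edgeSum-homo E g w))

module ℕ-Sum = EndSum ℕₚ.+-0-commutativeMonoid
module ℤ-Sum = EndSum ℤₚ.+-0-commutativeMonoid
module ℙ-Sum = EndSum ℙₚ.+-0-commutativeMonoid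

sumℕ≡sum : (f : Fin m → ℕ) → sumℕ f ≡ ℕ-Sum.sum f
sumℕ≡sum {zero}  f = refl
sumℕ≡sum {suc m} f = cong (f zero +_) (sumℕ≡sum (f ∘ suc))

sumℤ≡sum : (f : Fin m → ℤ) → sumℤ f ≡ ℤ-Sum.sum f
sumℤ≡sum {zero}  f = refl
sumℤ≡sum {suc m} f = cong (f zero +ᶻ_) (sumℤ≡sum (f ∘ suc))

sum-mono : {f g : Fin n → ℕ} → (∀ i → f i ≤ g i) → ℕ-Sum.sum f ≤ ℕ-Sum.sum g
sum-mono {zero}  f≤g = z≤n
sum-mono {suc n} f≤g = ℕₚ.+-mono-≤ (f≤g zero) (sum-mono (f≤g ∘ suc))

≤-sum : (f : Fin n → ℕ) (i : Fin n) → f i ≤ ℕ-Sum.sum f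
≤-sum {suc n} f i = subst (f i ≤_) (sym (ℕ-Sum.sum-remove f)) (ℕₚ.m≤m+n (f i) _)

sum-ones : ∀ n → ℕ-Sum.sum {n} (const 1) ≡ n
sum-ones zero    = refl
sum-ones (suc n) = cong suc (sum-ones n)

sumOver-filter-≤ : {P : Pred (Fin n) 0ℓ} (P? : Decidable P) (f : Fin n → ℕ) →
  ℕ-Sum.sumOver (filter P? (allFin n)) f ≤ ℕ-Sum.sum f
sumOver-filter-≤ {n} P? f = begin
  ℕ-Sum.sumOver (filter P? (allFin n)) f
    ≡⟨ ℕ-Sum.sumOver-filter P? (allFin n) f ⟩
  ℕ-Sum.sumOver (allFin n) (λ x → if ⌊ P? x ⌋ then f x else 0)
    ≡⟨ ℕ-Sum.sumOver-tabulate id (λ x → if ⌊ P? x ⌋ then f x else 0) ⟩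
  ℕ-Sum.sum (λ x → if ⌊ P? x ⌋ then f x else 0)
    ≤⟨ sum-mono (λ x → if-≤ ⌊ P? x ⌋) ⟩
  ℕ-Sum.sum f ∎
  where
  open ℕₚ.≤-Reasoning
  if-≤ : ∀ b {k} → (if b then k else 0) ≤ k
  if-≤ true  = ℕₚ.≤-refl
  if-≤ false = z≤n

degree : Ends m n → Fin n → ℕ
degree E v = ℕ-Sum.endSum E (λ _ _ → 1) (just v)

degree≡length : (E : Ends m n) (v : Fin n) → degree E v ≡ length (EndsAt.endsAt E (just v))
degree≡length E v = trans (ℕ-Sum.endSum-endsAt E (λ _ _ → 1) (just v)) (sum-ones _)

deg≡degree : ∀ G v → deg G v ≡ degree (end G) v
deg≡degree G v = sumℕ≡sum (ℕ-Sum.edgeSum (end G) (λ _ _ → 1) (just v))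

cubic⇒degree≡3 : ∀ G → Cubic G → ∀ v → degree (end G) v ≡ 3
cubic⇒degree≡3 G (_ , deg≡3) v = trans (sym (deg≡degree G v)) (deg≡3 v)

-- Parities and boundaries

even-or-odd : ∀ p → p ≡ 0ℙ ⊎ p ≡ 1ℙ
even-or-odd 0ℙ = inj₁ refl
even-or-odd 1ℙ = inj₂ refl

parityℤ : ℤ → Parity
parityℤ z = parity ∣ z ∣

parityℤ-⊖ : ∀ a b → parityℤ (a ⊖ b) ≡ parity a +ᵖ parity b
parityℤ-⊖ a       zero    = sym (ℙₚ.+-identityʳ (parity a))
parityℤ-⊖ zero    (suc b) = refl
parityℤ-⊖ (suc a) (suc b) = begin
  parityℤ (suc a ⊖ suc b)                ≡⟨ cong parityℤ (ℤₚ.[1+m]⊖[1+n]≡m⊖n a b) ⟩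
  parityℤ (a ⊖ b)                        ≡⟨ parityℤ-⊖ a b ⟩
  parity a +ᵖ parity b                   ≡⟨ interchange 1ℙ (parity a) 1ℙ (parity b) ⟨
  (1ℙ +ᵖ parity a) +ᵖ (1ℙ +ᵖ parity b)   ≡⟨ cong₂ _+ᵖ_ (ℙₚ.+-homo-+ 1 a) (ℙₚ.+-homo-+ 1 b) ⟨
  parity (suc a) +ᵖ parity (suc b)       ∎
  where
  open ≡-Reasoning
  open CommutativeSemigroupProperties ℙₚ.+-commutativeSemigroup using (interchange)

parityℤ-+ : ∀ i j → parityℤ (i +ᶻ j) ≡ parityℤ i +ᵖ parityℤ j
parityℤ-+ (nonneg a) (nonneg b) = ℙₚ.+-homo-+ a b
parityℤ-+ (nonneg a) -[1+ b ]   = parityℤ-⊖ a (suc b)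
parityℤ-+ -[1+ a ]   (nonneg b) =
  trans (parityℤ-⊖ b (suc a)) (ℙₚ.+-comm (parity b) (parity (suc a)))
parityℤ-+ -[1+ a ]   -[1+ b ]   =
  trans (cong (parity ∘ suc) (sym (ℕₚ.+-suc a b))) (ℙₚ.+-homo-+ (suc a) (suc b))

parityℤ-isMonoidHomomorphism : IsMonoidHomomorphism
  (CommutativeMonoid.rawMonoid ℤₚ.+-0-commutativeMonoid)
  (CommutativeMonoid.rawMonoid ℙₚ.+-0-commutativeMonoid) parityℤ
parityℤ-isMonoidHomomorphism = record
  { isMagmaHomomorphism = record
    { isRelHomomorphism = record { cong = cong parityℤ }
    ; homo = parityℤ-+
    }
  ; ε-homo = refl
  }

module ℕ⇒ℙ = EndSumHomomorphism ℕₚ.+-0-commutativeMonoid ℙₚ.+-0-commutativeMonoid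
  ℙₚ.parity-isMonoidHomomorphism
module ℤ⇒ℙ = EndSumHomomorphism ℤₚ.+-0-commutativeMonoid ℙₚ.+-0-commutativeMonoid
  parityℤ-isMonoidHomomorphism

boundary : Ends m n → (Fin m → Parity) → Site n → Parity
boundary E x = ℙ-Sum.endSum E λ e _ → x e

-- End 0 of an edge is its tail: c units sent along the edge leave end 0 and enter end 1.
signed : Fin 2 → ℤ → ℤ
signed 0F c = -ᶻ c
signed 1F c = c

parity-signed : ∀ i c → parityℤ (signed i c) ≡ parityℤ c
parity-signed 0F c = cong parity (ℤₚ.∣-i∣≡∣i∣ c)
parity-signed 1F c = refl

edgeExcess : Ends m n → Fin m → ℤ → Site n → ℤ
edgeExcess E e c w = ℤ-Sum.edgeSum E (λ _ i → signed i c) w e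

parity-edgeExcess : (E : Ends m n) (e : Fin m) (c : ℤ) (w : Site n) →
  parityℤ (edgeExcess E e c w) ≡ ℙ-Sum.edgeSum E (λ _ _ → parityℤ c) w e
parity-edgeExcess E e c w = trans
  (ℤ⇒ℙ.edgeSum-homo E (λ _ i → signed i c) w e)
  (ℙ-Sum.sum-cong-≗ λ i → cong (λ p → ℙ-Sum.mass (E e i) p w) (parity-signed i c))

excess : Ends m n → (Fin m → ℤ) → Site n → ℤ
excess E x w = ℤ-Sum.sum λ e → edgeExcess E e (x e) w

parity-excess : (E : Ends m n) (x : Fin m → ℤ) (w : Site n) →
  parityℤ (excess E x w) ≡ boundary E (parityℤ ∘ x) w
parity-excess E x w = trans
  (ℤ⇒ℙ.sum-homo λ e → edgeExcess E e (x e) w)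
  (ℙ-Sum.sum-cong-≗ λ e → parity-edgeExcess E e (x e) w)

excess-+ : (E : Ends m n) (x y : Fin m → ℤ) (w : Site n) →
  excess E (λ e → x e +ᶻ y e) w ≡ excess E x w +ᶻ excess E y w
excess-+ E x y w = trans (ℤ-Sum.endSum-cong E w λ e i → signed-+ i (x e) (y e))
  (ℤ-Sum.endSum-∙ E (λ e i → signed i (x e)) (λ e i → signed i (y e)) w)
  where
  signed-+ : ∀ i c d → signed i (c +ᶻ d) ≡ signed i c +ᶻ signed i d
  signed-+ 0F c d = ℤₚ.neg-distrib-+ c d
  signed-+ 1F c d = refl

odd-boundary⇒odd-edge : (E : Ends m n) (x : Fin m → Parity) (w : Site n) →
  boundary E x w ≡ 1ℙ → Σ[ e ∈ Fin m ] Σ[ i ∈ Fin 2 ] x e ≡ 1ℙ × E e i ≡ w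
odd-boundary⇒odd-edge E x w odd
  with any? (λ e → any? λ i → (x e ℙₚ.≟ 1ℙ) ×-dec (E e i ≟ᵐ w))
... | yes found = found
... | no none   = contradiction
  (trans (sym odd) (ℙ-Sum.sum-zero λ e → ℙ-Sum.sum-zero λ i → even e i)) λ ()
  where
  even : ∀ e i → ℙ-Sum.mass (E e i) (x e) w ≡ 0ℙ
  even e i with x e in xₑ
  ... | 0ℙ = ℙ-Sum.mass-ε (E e i) w
  ... | 1ℙ = ℙ-Sum.mass-≢ 1ℙ λ at-w → none (e , i , xₑ , at-w)

-- Dipoles and trails

dipole : Site n → Site n → Site n → ℤ
dipole a b w = ℤ-Sum.mass a -1ℤ w +ᶻ ℤ-Sum.mass b 1ℤ w

dipole-loop : (a w : Site n) → dipole a a w ≡ 0ℤ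
dipole-loop a w = trans (sym (ℤ-Sum.mass-∙ a -1ℤ 1ℤ w)) (ℤ-Sum.mass-ε a w)

dipole-chain : (a b c w : Site n) → dipole a b w +ᶻ dipole b c w ≡ dipole a c w
dipole-chain a b c w = begin
  (a⁻ +ᶻ b⁺) +ᶻ (b⁻ +ᶻ c⁺)   ≡⟨ regroup a⁻ b⁺ b⁻ c⁺ ⟩
  dipole b b w +ᶻ (a⁻ +ᶻ c⁺) ≡⟨ cong (_+ᶻ (a⁻ +ᶻ c⁺)) (dipole-loop b w) ⟩
  0ℤ +ᶻ (a⁻ +ᶻ c⁺)           ≡⟨ ℤₚ.+-identityˡ (a⁻ +ᶻ c⁺) ⟩
  a⁻ +ᶻ c⁺                   ∎
  where
  open ≡-Reasoning
  a⁻ b⁻ b⁺ c⁺ : ℤ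
  a⁻ = ℤ-Sum.mass a -1ℤ w
  b⁻ = ℤ-Sum.mass b -1ℤ w
  b⁺ = ℤ-Sum.mass b 1ℤ w
  c⁺ = ℤ-Sum.mass c 1ℤ w
  regroup : ∀ i j k l → (i +ᶻ j) +ᶻ (k +ᶻ l) ≡ (k +ᶻ j) +ᶻ (i +ᶻ l)
  regroup = solve-∀

dipole-odd : {a b : Site n} → a ≢ b → parityℤ (dipole a b a) ≡ 1ℙ
dipole-odd {a = a} a≢b = cong parityℤ
  (cong₂ _+ᶻ_ (ℤ-Sum.mass-≡ {x = a} -1ℤ refl) (ℤ-Sum.mass-≢ 1ℤ (a≢b ∘ sym)))

data _lifts_ : ℤ → Parity → Set where
  zero  : 0ℤ lifts 0ℙ
  plus  : 1ℤ lifts 1ℙ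
  minus : -1ℤ lifts 1ℙ

lifts⇒parity : ∀ {i p} → i lifts p → parityℤ i ≡ p
lifts⇒parity zero  = refl
lifts⇒parity plus  = refl
lifts⇒parity minus = refl

SignedLift : Ends m n → (Fin m → Parity) → (Site n → ℤ) → Set
SignedLift {m} E x D = Σ[ y ∈ (Fin m → ℤ) ] (∀ e → y e lifts x e) × (∀ w → excess E y w ≡ D w)

SignedLift-cong : (E : Ends m n) (x : Fin m → Parity) {D D′ : Site n → ℤ} →
  (∀ w → D w ≡ D′ w) → SignedLift E x D → SignedLift E x D′
SignedLift-cong E x D≡D′ (y , y-lifts , y-excess) = y , y-lifts , λ w → trans (y-excess w) (D≡D′ w)

insert-edge : (E : Ends (suc m) n) (x : Fin (suc m) → Parity) (j : Fin (suc m))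
  {c : ℤ} {D : Site n → ℤ} → c lifts x j → SignedLift (removeAt E j) (removeAt x j) D →
  SignedLift E x λ w → edgeExcess E j c w +ᶻ D w
insert-edge E x j {c} {D} c-lifts (y , y-lifts , y-excess) = y⁺ , y⁺-lifts , y⁺-excess
  where
  y⁺ = insertAt y j c
  y⁺-lifts : ∀ e → y⁺ e lifts x e
  y⁺-lifts = punchIn-cases j (subst (_lifts x j) (sym (insertAt-lookup y j c)) c-lifts)
    λ i → subst (_lifts x (punchIn j i)) (sym (insertAt-punchIn y j c i)) (y-lifts i)
  y⁺-excess : ∀ w → excess E y⁺ w ≡ edgeExcess E j c w +ᶻ D w
  y⁺-excess w = begin
    excess E y⁺ w
      ≡⟨ ℤ-Sum.sum-remove (λ e → edgeExcess E e (y⁺ e) w) ⟩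
    edgeExcess E j (y⁺ j) w +ᶻ excess (removeAt E j) (removeAt y⁺ j) w
      ≡⟨ cong₂ _+ᶻ_ (cong (λ d → edgeExcess E j d w) (insertAt-lookup y j c))
           (ℤ-Sum.sum-cong-≗ λ i →
             cong (λ d → edgeExcess E (punchIn j i) d w) (insertAt-punchIn y j c i)) ⟩
    edgeExcess E j c w +ᶻ excess (removeAt E j) y w
      ≡⟨ cong (edgeExcess E j c w +ᶻ_) (y-excess w) ⟩
    edgeExcess E j c w +ᶻ D w ∎
    where open ≡-Reasoning

boundary-removeAt : (E : Ends (suc m) n) (x : Fin (suc m) → Parity) (j : Fin (suc m))
  {c : ℤ} {D : Site n → ℤ} → c lifts x j →
  (∀ w → boundary E x w ≡ parityℤ (edgeExcess E j c w +ᶻ D w)) →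
  ∀ w → boundary (removeAt E j) (removeAt x j) w ≡ parityℤ (D w)
boundary-removeAt E x j {c} {D} c-lifts x-boundary w = ℙₚ.+-cancelˡ-≡ (at-j (x j)) _ _ (begin
  at-j (x j) +ᵖ boundary (removeAt E j) (removeAt x j) w
    ≡⟨ ℙ-Sum.sum-remove (ℙ-Sum.edgeSum E (λ e _ → x e) w) ⟨
  boundary E x w
    ≡⟨ x-boundary w ⟩
  parityℤ (edgeExcess E j c w +ᶻ D w)
    ≡⟨ parityℤ-+ (edgeExcess E j c w) (D w) ⟩
  parityℤ (edgeExcess E j c w) +ᵖ parityℤ (D w)
    ≡⟨ cong (_+ᵖ parityℤ (D w)) (parity-edgeExcess E j c w) ⟩
  at-j (parityℤ c) +ᵖ parityℤ (D w)
    ≡⟨ cong (λ p → at-j p +ᵖ parityℤ (D w)) (lifts⇒parity c-lifts) ⟩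
  at-j (x j) +ᵖ parityℤ (D w) ∎)
  where
  open ≡-Reasoning
  at-j : Parity → Parity
  at-j p = ℙ-Sum.edgeSum E (λ _ _ → p) w j

lift-through-edge : (E : Ends (suc m) n) (x : Fin (suc m) → Parity) (j : Fin (suc m))
  {c : ℤ} {D D′ : Site n → ℤ} → c lifts x j → (∀ w → edgeExcess E j c w +ᶻ D w ≡ D′ w) →
  ((∀ w → boundary (removeAt E j) (removeAt x j) w ≡ parityℤ (D w)) →
    SignedLift (removeAt E j) (removeAt x j) D) →
  (∀ w → boundary E x w ≡ parityℤ (D′ w)) → SignedLift E x D′
lift-through-edge E x j c-lifts split lift-rest x-boundary =
  SignedLift-cong E x split (insert-edge E x j c-lifts
    (lift-rest (boundary-removeAt E x j c-lifts λ w →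
      trans (x-boundary w) (cong parityℤ (sym (split w))))))

outward : Fin 2 → ℤ
outward 0F = 1ℤ
outward 1F = -1ℤ

outward-lifts : ∀ i → outward i lifts 1ℙ
outward-lifts 0F = plus
outward-lifts 1F = minus

edgeExcess-outward : (E : Ends m n) (e : Fin m) (i : Fin 2) (w : Site n) →
  edgeExcess E e (outward i) w ≡ dipole (E e i) (E e (swap2 i)) w
edgeExcess-outward E e 0F w = cong (ℤ-Sum.mass (E e 0F) -1ℤ w +ᶻ_) (ℤₚ.+-identityʳ _)
edgeExcess-outward E e 1F w = trans
  (cong (ℤ-Sum.mass (E e 0F) 1ℤ w +ᶻ_) (ℤₚ.+-identityʳ _))
  (ℤₚ.+-comm (ℤ-Sum.mass (E e 0F) 1ℤ w) (ℤ-Sum.mass (E e 1F) -1ℤ w))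

edgeExcess-0 : (E : Ends m n) (e : Fin m) (w : Site n) → edgeExcess E e 0ℤ w ≡ 0ℤ
edgeExcess-0 E e w = ℤ-Sum.sum-zero {f = λ i → ℤ-Sum.mass (E e i) (signed i 0ℤ) w}
  λ { 0F → ℤ-Sum.mass-ε (E e 0F) w ; 1F → ℤ-Sum.mass-ε (E e 1F) w }

-- A trail from a to b is walked edge by edge: if a ≠ b, then an odd number of odd edges are at a,
-- so there is one to leave a by; if a = b, then the first edge, if odd, starts a new closed trail.
trail-lift : (E : Ends m n) (x : Fin m → Parity) (a b : Site n) →
  (∀ w → boundary E x w ≡ parityℤ (dipole a b w)) → SignedLift E x (dipole a b)
trail-lift {zero} E x a b x-boundary with a ≟ᵐ b
... | yes refl = (λ ()) , (λ ()) , λ w → sym (dipole-loop a w)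
... | no a≢b   = contradiction (trans (x-boundary a) (dipole-odd a≢b)) λ ()
trail-lift {suc m} E x a b x-boundary with a ≟ᵐ b
... | no a≢b
  with j , i , odd , refl ← odd-boundary⇒odd-edge E x a (trans (x-boundary a) (dipole-odd a≢b))
  = lift-through-edge E x j (subst (outward i lifts_) (sym odd) (outward-lifts i))
      (λ w → trans (cong (_+ᶻ dipole c b w) (edgeExcess-outward E j i w)) (dipole-chain a c b w))
      (trail-lift (removeAt E j) (removeAt x j) c b) x-boundary
  where
  c : Site _
  c = E j (swap2 i)
... | yes refl with even-or-odd (x zero)
...   | inj₁ even = lift-through-edge E x zero (subst (0ℤ lifts_) (sym even) zero)
  (λ w → trans (cong (_+ᶻ dipole a a w) (edgeExcess-0 E zero w)) (ℤₚ.+-identityˡ (dipole a a w)))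
  (trail-lift (removeAt E zero) (removeAt x zero) a a) x-boundary
...   | inj₂ odd = lift-through-edge E x zero (subst (1ℤ lifts_) (sym odd) plus)
  (λ w → begin
    edgeExcess E zero 1ℤ w +ᶻ dipole t s w
      ≡⟨ cong (_+ᶻ dipole t s w) (edgeExcess-outward E zero 0F w) ⟩
    dipole s t w +ᶻ dipole t s w   ≡⟨ dipole-chain s t s w ⟩
    dipole s s w                   ≡⟨ dipole-loop s w ⟩
    0ℤ                             ≡⟨ dipole-loop a w ⟨
    dipole a a w                   ∎)
  (trail-lift (removeAt E zero) (removeAt x zero) t s) x-boundary
  where
  open ≡-Reasoning
  s t : Site _
  s = E zero 0F
  t = E zero 1F

-- Colours as the nonzero elements of ℤ₂ × ℤ₂

bit : Fin 2 → Fin 3 → Parity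
bit 0F 0F = 1ℙ
bit 0F 1F = 0ℙ
bit 0F 2F = 1ℙ
bit 1F 0F = 0ℙ
bit 1F 1F = 1ℙ
bit 1F 2F = 1ℙ

AllDistinct : (Fin n → Fin 3) → Set
AllDistinct c = ∀ i j → c i ≡ c j → i ≡ j

ZeroSum : (Fin n → Fin 3) → Set
ZeroSum c = ∀ b → ℙ-Sum.sum (bit b ∘ c) ≡ 0ℙ

AllDistinct-resp : {c d : Fin n → Fin 3} → c ≗ d → AllDistinct c → AllDistinct d
AllDistinct-resp c≗d distinct i j di≡dj =
  distinct i j (trans (c≗d i) (trans di≡dj (sym (c≗d j))))

ZeroSum-resp : {c d : Fin n → Fin 3} → c ≗ d → ZeroSum c → ZeroSum d
ZeroSum-resp c≗d zero-sum b =
  trans (ℙ-Sum.sum-cong-≗ λ i → cong (bit b) (sym (c≗d i))) (zero-sum b)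

allDistinct? : (c : Fin n → Fin 3) → Dec (AllDistinct c)
allDistinct? c = all? λ i → all? λ j → (c i ≟ᶠ c j) →-dec (i ≟ᶠ j)

zeroSum? : (c : Fin n → Fin 3) → Dec (ZeroSum c)
zeroSum? c = all? λ b → ℙ-Sum.sum (bit b ∘ c) ℙₚ.≟ 0ℙ

allDistinct⇔zeroSum : n ≡ 3 → (c : Fin n → Fin 3) → AllDistinct c ⇔ ZeroSum c
allDistinct⇔zeroSum refl = from-yes (all-maps? {P = λ c → AllDistinct c ⇔ ZeroSum c} resp
  λ c → map′ (uncurry mk⇔) (λ c⇔ → to c⇔ , from c⇔)
    ((allDistinct? c →-dec zeroSum? c) ×-dec (zeroSum? c →-dec allDistinct? c)))
  where
  resp : {c d : Fin 3 → Fin 3} → c ≗ d → AllDistinct c ⇔ ZeroSum c → AllDistinct d ⇔ ZeroSum d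
  resp c≗d c⇔ = mk⇔
    (ZeroSum-resp c≗d ∘ to c⇔ ∘ AllDistinct-resp (sym ∘ c≗d))
    (AllDistinct-resp c≗d ∘ from c⇔ ∘ ZeroSum-resp (sym ∘ c≗d))

module _ (E : Ends m n) (c : Fin m → Fin 3) (v : Fin n) where

  open EndsAt E (just v)

  ProperAt : Set
  ProperAt = ∀ e i e′ i′ → (e , i) ≢ (e′ , i′) →
    E e i ≡ just v → E e′ i′ ≡ just v → c e ≢ c e′

  KleinAt : Set
  KleinAt = ∀ b → boundary E (bit b ∘ c) (just v) ≡ 0ℙ

  coloursAt : Fin (length endsAt) → Fin 3
  coloursAt j = c (proj₁ (lookup endsAt j))

  proper⇒allDistinct : ProperAt → AllDistinct coloursAt
  proper⇒allDistinct proper i j same = decidable-stable (i ≟ᶠ j) λ i≢j →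
    proper _ _ _ _ (i≢j ∘ lookup-injective endsAt-unique) (lookup-at i) (lookup-at j) same
    where
    lookup-at : ∀ i → uncurry E (lookup endsAt i) ≡ just v
    lookup-at i = to (∈-endsAt _ _) (∈-lookup i)

  allDistinct⇒proper : AllDistinct coloursAt → ProperAt
  allDistinct⇒proper distinct e i e′ i′ ends-differ at-v at-v′ same = ends-differ (begin
    (e , i)
      ≡⟨ lookup-index e,i∈ ⟩
    lookup endsAt (index e,i∈)
      ≡⟨ cong (lookup endsAt) (distinct (index e,i∈) (index e′,i′∈) colours-agree) ⟩
    lookup endsAt (index e′,i′∈)
      ≡⟨ lookup-index e′,i′∈ ⟨
    (e′ , i′) ∎)
    where
    open ≡-Reasoning
    e,i∈ : (e , i) ∈ endsAt
    e,i∈ = from (∈-endsAt e i) at-v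
    e′,i′∈ : (e′ , i′) ∈ endsAt
    e′,i′∈ = from (∈-endsAt e′ i′) at-v′
    colours-agree : coloursAt (index e,i∈) ≡ coloursAt (index e′,i′∈)
    colours-agree = begin
      coloursAt (index e,i∈)     ≡⟨ cong (c ∘ proj₁) (lookup-index e,i∈) ⟨
      c e                        ≡⟨ same ⟩
      c e′                       ≡⟨ cong (c ∘ proj₁) (lookup-index e′,i′∈) ⟩
      coloursAt (index e′,i′∈)   ∎

  klein⇔zeroSum : KleinAt ⇔ ZeroSum coloursAt
  klein⇔zeroSum = mk⇔ (λ klein b → trans (sym (boundary≡sum b)) (klein b))
    (λ zero-sum b → trans (boundary≡sum b) (zero-sum b))
    where
    boundary≡sum : ∀ b → boundary E (bit b ∘ c) (just v) ≡ ℙ-Sum.sum (bit b ∘ coloursAt)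
    boundary≡sum b = ℙ-Sum.endSum-endsAt E (λ e _ → bit b (c e)) (just v)

  proper⇔klein : degree E v ≡ 3 → ProperAt ⇔ KleinAt
  proper⇔klein degree≡3 = ⇔-sym klein⇔zeroSum ⇔-∘
    (allDistinct⇔zeroSum (trans (sym (degree≡length E v)) degree≡3) coloursAt ⇔-∘
      mk⇔ proper⇒allDistinct allDistinct⇒proper)

-- Nowhere-zero 4-flows

Circulation : Ends m n → (Fin m → ℤ) → Set
Circulation {n = n} E x = (v : Fin n) → excess E x (just v) ≡ 0ℤ

FourFlow : Ends m n → Set
FourFlow {m} E = Σ[ x ∈ (Fin m → ℤ) ] (∀ e → 1 ≤ ∣ x e ∣ × ∣ x e ∣ ≤ 3) × Circulation E x

KleinFlow : Ends m n → Set
KleinFlow {m} {n} E = Σ[ c ∈ (Fin m → Fin 3) ] ((v : Fin n) → KleinAt E c v)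

module _ (G : Graph) where

  along : (Fin (nE G) → Bool) → (Fin (nE G) → ℤ) → Fin (nE G) → ℤ
  along o f e = if o e then -ᶻ f e else f e

  ∣along∣ : ∀ o f e → ∣ along o f e ∣ ≡ ∣ f e ∣
  ∣along∣ o f e with o e
  ... | true  = ℤₚ.∣-i∣≡∣i∣ (f e)
  ... | false = refl

  netInflow : (Fin (nE G) → Bool) → (Fin (nE G) → ℤ) → Site (nV G) → Fin (nE G) → ℤ
  netInflow o f w e = ℤ-Sum.mass (headE G o e) (f e) w -ᶻ ℤ-Sum.mass (tailE G o e) (f e) w

  netInflow≡edgeExcess : ∀ o f w e → netInflow o f w e ≡ edgeExcess (end G) e (along o f e) w
  netInflow≡edgeExcess o f w e with o e
  ... | false = trans
    (regroup (ℤ-Sum.mass (end G e 1F) (f e) w) (ℤ-Sum.mass (end G e 0F) (f e) w))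
    (cong (_+ᶻ (ℤ-Sum.mass (end G e 1F) (f e) w +ᶻ 0ℤ)) (if-float -ᶻ_ ⌊ end G e 0F ≟ᵐ w ⌋))
    where
    regroup : ∀ i j → i -ᶻ j ≡ -ᶻ j +ᶻ (i +ᶻ 0ℤ)
    regroup = solve-∀
  ... | true  = cong₂ _+ᶻ_
    (cong (λ c → ℤ-Sum.mass (end G e 0F) c w) (sym (ℤₚ.neg-involutive (f e))))
    (trans (if-float -ᶻ_ ⌊ end G e 1F ≟ᵐ w ⌋) (sym (ℤₚ.+-identityʳ _)))

  kirchhoff-excess : ∀ o f v → sumℤ (netInflow o f (just v)) ≡ excess (end G) (along o f) (just v)
  kirchhoff-excess o f v = trans (sumℤ≡sum (netInflow o f (just v)))
    (ℤ-Sum.sum-cong-≗ (netInflow≡edgeExcess o f (just v)))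

  nz4Flow⇔fourFlow : HasNZ4Flow G ⇔ FourFlow (end G)
  nz4Flow⇔fourFlow = mk⇔
    (λ (o , f , bounds , kirchhoff) → along o f ,
      (λ e → subst (λ k → 1 ≤ k × k ≤ 3) (sym (∣along∣ o f e)) (bounds e)) ,
      λ v → trans (sym (kirchhoff-excess o f v)) (kirchhoff v))
    (λ (x , bounds , circulation) → const false , x , bounds ,
      λ v → trans (kirchhoff-excess (const false) x v) (circulation v))

even⇒double : ∀ k → parity k ≡ 0ℙ → ∃ λ h → k ≡ h + h
even⇒double zero          _    = 0 , refl
even⇒double (suc (suc k)) even with h , k≡h+h ← even⇒double k even =
  suc h , cong suc (trans (cong suc k≡h+h) (sym (ℕₚ.+-suc h h)))

even⇒doubleℤ : ∀ z → parityℤ z ≡ 0ℙ → ∃ λ h → z ≡ h +ᶻ h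
even⇒doubleℤ (nonneg k) even with h , k≡h+h ← even⇒double k even = nonneg h , cong nonneg k≡h+h
even⇒doubleℤ -[1+ k ]   even with h , k≡h+h ← even⇒double (suc k) even =
  -ᶻ nonneg h , trans (cong (λ i → -ᶻ nonneg i) k≡h+h) (ℤₚ.neg-distrib-+ (nonneg h) (nonneg h))

double≡0⇒≡0 : ∀ z → z +ᶻ z ≡ 0ℤ → z ≡ 0ℤ
double≡0⇒≡0 (nonneg zero) _ = refl

∣∣-double : ∀ z → ∣ z +ᶻ z ∣ ≡ ∣ z ∣ + ∣ z ∣
∣∣-double (nonneg k) = refl
∣∣-double -[1+ k ]   = cong suc (sym (ℕₚ.+-suc k k))

odd-or-half-odd : ∀ x y h → 1 ≤ ∣ x ∣ → ∣ x ∣ ≤ 3 → y lifts parityℤ x → x +ᶻ y ≡ h +ᶻ h →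
  parityℤ x ≡ 1ℙ ⊎ parityℤ h ≡ 1ℙ
odd-or-half-odd x y h 1≤∣x∣ ∣x∣≤3 y-lifts x+y≡h+h with parityℤ x in x-parity | y-lifts
... | 1ℙ | _    = inj₁ refl
... | 0ℙ | zero = inj₂ (double≡2⇒odd ∣ h ∣ (begin
  ∣ h ∣ + ∣ h ∣   ≡⟨ ∣∣-double h ⟨
  ∣ h +ᶻ h ∣      ≡⟨ cong ∣_∣ x+y≡h+h ⟨
  ∣ x +ᶻ 0ℤ ∣     ≡⟨ cong ∣_∣ (ℤₚ.+-identityʳ x) ⟩
  ∣ x ∣           ≡⟨ even⇒≡2 ∣ x ∣ 1≤∣x∣ ∣x∣≤3 x-parity ⟩
  2               ∎))
  where
  open ≡-Reasoning
  even⇒≡2 : ∀ k → 1 ≤ k → k ≤ 3 → parity k ≡ 0ℙ → k ≡ 2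
  even⇒≡2 2 _ _ _ = refl
  even⇒≡2 (suc (suc (suc (suc _)))) _ (s≤s (s≤s (s≤s ()))) _
  double≡2⇒odd : ∀ k → k + k ≡ 2 → parity k ≡ 1ℙ
  double≡2⇒odd 1             _  = refl
  double≡2⇒odd (suc (suc k)) eq =
    contradiction (ℕₚ.suc-injective (ℕₚ.suc-injective eq)) (ℕₚ.m+1+n≢0 k)

signed-bits-bounds : ∀ k {a b} → a lifts bit 0F k → b lifts bit 1F k →
  1 ≤ ∣ a +ᶻ (b +ᶻ b) ∣ × ∣ a +ᶻ (b +ᶻ b) ∣ ≤ 3
signed-bits-bounds 0F plus  zero  = s≤s z≤n , s≤s z≤n
signed-bits-bounds 0F minus zero  = s≤s z≤n , s≤s z≤n
signed-bits-bounds 1F zero  plus  = s≤s z≤n , s≤s (s≤s z≤n)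
signed-bits-bounds 1F zero  minus = s≤s z≤n , s≤s (s≤s z≤n)
signed-bits-bounds 2F plus  plus  = s≤s z≤n , s≤s (s≤s (s≤s z≤n))
signed-bits-bounds 2F plus  minus = s≤s z≤n , s≤s z≤n
signed-bits-bounds 2F minus plus  = s≤s z≤n , s≤s z≤n
signed-bits-bounds 2F minus minus = s≤s z≤n , s≤s (s≤s (s≤s z≤n))

colour-with-bits : ∀ p q → p ≡ 1ℙ ⊎ q ≡ 1ℙ → Σ[ k ∈ Fin 3 ] bit 0F k ≡ p × bit 1F k ≡ q
colour-with-bits 1ℙ 0ℙ _ = 0F , refl , refl
colour-with-bits 0ℙ 1ℙ _ = 1F , refl , refl
colour-with-bits 1ℙ 1ℙ _ = 2F , refl , refl
colour-with-bits 0ℙ 0ℙ (inj₁ ())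
colour-with-bits 0ℙ 0ℙ (inj₂ ())

circulation⇒even : (E : Ends m n) (x : Fin m → ℤ) → Circulation E x →
  ∀ v → boundary E (parityℤ ∘ x) (just v) ≡ 0ℙ
circulation⇒even E x x-circ v = trans (sym (parity-excess E x (just v))) (cong parityℤ (x-circ v))

circulation-+ : (E : Ends m n) {x y : Fin m → ℤ} → Circulation E x → Circulation E y →
  Circulation E λ e → x e +ᶻ y e
circulation-+ E {x} {y} x-circ y-circ v =
  trans (excess-+ E x y (just v)) (cong₂ _+ᶻ_ (x-circ v) (y-circ v))

half-circulation : (E : Ends m n) {x y : Fin m → ℤ} → Circulation E x → Circulation E y →
  (∀ e → parityℤ (x e) ≡ parityℤ (y e)) →
  Σ[ h ∈ (Fin m → ℤ) ] (∀ e → x e +ᶻ y e ≡ h e +ᶻ h e) × Circulation E h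
half-circulation {m} E {x} {y} x-circ y-circ same-parity = h , proj₂ ∘ halves , λ v →
  double≡0⇒≡0 (excess E h (just v)) (begin
    excess E h (just v) +ᶻ excess E h (just v)
      ≡⟨ excess-+ E h h (just v) ⟨
    excess E (λ e → h e +ᶻ h e) (just v)
      ≡⟨ ℤ-Sum.sum-cong-≗ (λ e → cong (λ c → edgeExcess E e c (just v)) (proj₂ (halves e))) ⟨
    excess E (λ e → x e +ᶻ y e) (just v)
      ≡⟨ circulation-+ E x-circ y-circ v ⟩
    0ℤ ∎)
  where
  open ≡-Reasoning
  halves : ∀ e → ∃ λ h → x e +ᶻ y e ≡ h +ᶻ h
  halves e = even⇒doubleℤ (x e +ᶻ y e) (begin
    parityℤ (x e +ᶻ y e)             ≡⟨ parityℤ-+ (x e) (y e) ⟩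
    parityℤ (x e) +ᵖ parityℤ (y e)   ≡⟨ cong (_+ᵖ parityℤ (y e)) (same-parity e) ⟩
    parityℤ (y e) +ᵖ parityℤ (y e)   ≡⟨ ℙₚ.p+p≡0ℙ (parityℤ (y e)) ⟩
    0ℙ                               ∎)
  h : Fin m → ℤ
  h = proj₁ ∘ halves

circulations⇒kleinFlow : (E : Ends m n) {x y : Fin m → ℤ} → Circulation E x → Circulation E y →
  (∀ e → parityℤ (x e) ≡ 1ℙ ⊎ parityℤ (y e) ≡ 1ℙ) → KleinFlow E
circulations⇒kleinFlow E {x} {y} x-circ y-circ odd = proj₁ ∘ colours , λ where
    v 0F → trans (ℙ-Sum.endSum-cong E (just v) λ e _ → proj₁ (proj₂ (colours e)))
                 (circulation⇒even E x x-circ v)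
    v 1F → trans (ℙ-Sum.endSum-cong E (just v) λ e _ → proj₂ (proj₂ (colours e)))
                 (circulation⇒even E y y-circ v)
  where
  colours : ∀ e → Σ[ k ∈ Fin 3 ] bit 0F k ≡ parityℤ (x e) × bit 1F k ≡ parityℤ (y e)
  colours e = colour-with-bits (parityℤ (x e)) (parityℤ (y e)) (odd e)

module _ (E : Ends m n) (closed : Closed E) where

  cycle-lift : (x : Fin m → Parity) → (∀ v → boundary E x (just v) ≡ 0ℙ) →
    Σ[ y ∈ (Fin m → ℤ) ] (∀ e → y e lifts x e) × Circulation E y
  cycle-lift x even =
    let y , y-lifts , y-excess = trail-lift E x nothing nothing even-everywhere in
    y , y-lifts , λ v → trans (y-excess (just v)) (dipole-loop nothing (just v))
    where
    even-everywhere : ∀ w → boundary E x w ≡ parityℤ (dipole nothing nothing w)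
    even-everywhere nothing  = ℙ-Sum.endSum-nothing E closed λ e _ → x e
    even-everywhere (just v) = even v

  fourFlow⇒kleinFlow : FourFlow E → KleinFlow E
  fourFlow⇒kleinFlow (x , bounds , x-circ) =
    let y , y-lifts , y-circ = cycle-lift (parityℤ ∘ x) (circulation⇒even E x x-circ)
        h , x+y≡h+h , h-circ =
          half-circulation E x-circ y-circ λ e → sym (lifts⇒parity (y-lifts e))
    in circulations⇒kleinFlow E x-circ h-circ λ e →
      odd-or-half-odd (x e) (y e) (h e) (proj₁ (bounds e)) (proj₂ (bounds e))
        (y-lifts e) (x+y≡h+h e)

  kleinFlow⇒fourFlow : KleinFlow E → FourFlow E
  kleinFlow⇒fourFlow (c , klein) =
    let a , a-lifts , a-circ = cycle-lift (bit 0F ∘ c) λ v → klein v 0F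
        b , b-lifts , b-circ = cycle-lift (bit 1F ∘ c) λ v → klein v 1F
    in (λ e → a e +ᶻ (b e +ᶻ b e)) , (λ e → signed-bits-bounds (c e) (a-lifts e) (b-lifts e)) ,
       circulation-+ E a-circ (circulation-+ E b-circ b-circ)

kleinFlow⇔nz4Flow : (G : Graph) → IsGraph G → KleinFlow (end G) ⇔ HasNZ4Flow G
kleinFlow⇔nz4Flow G closed = ⇔-sym (nz4Flow⇔fourFlow G) ⇔-∘
  mk⇔ (kleinFlow⇒fourFlow (end G) closed) (fourFlow⇒kleinFlow (end G) closed)

-- Handshaking

handshake : (E : Ends m n) → Closed E → (x : Fin m → Parity) →
  ℙ-Sum.sum (λ v → boundary E x (just v)) ≡ 0ℙ
handshake E closed x = trans (ℙ-Sum.endSum-total E closed λ e _ → x e)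
  (ℙ-Sum.sum-zero λ e → trans (cong (x e +ᵖ_) (ℙₚ.+-identityʳ (x e))) (ℙₚ.p+p≡0ℙ (x e)))

boundary-elsewhere : (E : Ends m n) → Closed E → (x : Fin m → Parity) (p : Fin n) →
  (∀ v → v ≢ p → boundary E x (just v) ≡ 0ℙ) → boundary E x (just p) ≡ 0ℙ
boundary-elsewhere E closed x p elsewhere = trans
  (sym (ℙ-Sum.sum-single (λ v → boundary E x (just v)) p elsewhere)) (handshake E closed x)

even-degree-sum : (E : Ends m n) → Closed E → parity (ℕ-Sum.sum (degree E)) ≡ 0ℙ
even-degree-sum E closed = begin
  parity (ℕ-Sum.sum (degree E))
    ≡⟨ ℕ⇒ℙ.sum-homo (degree E) ⟩
  ℙ-Sum.sum (λ v → parity (degree E v))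
    ≡⟨ ℙ-Sum.sum-cong-≗ (λ v → ℕ⇒ℙ.endSum-homo E (λ _ _ → 1) (just v)) ⟩
  ℙ-Sum.sum (λ v → boundary E (const 1ℙ) (just v))
    ≡⟨ handshake E closed (const 1ℙ) ⟩
  0ℙ ∎
  where open ≡-Reasoning

parity-sum-odd : {f : Fin n → ℕ} → (∀ i → parity (f i) ≡ 1ℙ) → parity (ℕ-Sum.sum f) ≡ parity n
parity-sum-odd {n} {f} odd = begin
  parity (ℕ-Sum.sum f)               ≡⟨ ℕ⇒ℙ.sum-homo f ⟩
  ℙ-Sum.sum (parity ∘ f)             ≡⟨ ℙ-Sum.sum-cong-≗ odd ⟩
  ℙ-Sum.sum {n} (const 1ℙ)           ≡⟨ ℕ⇒ℙ.sum-homo {n} (const 1) ⟨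
  parity (ℕ-Sum.sum {n} (const 1))   ≡⟨ cong parity (sum-ones n) ⟩
  parity n                           ∎
  where open ≡-Reasoning

cubic⇒even-order : ∀ G → Cubic G → parity (nV G) ≡ 0ℙ
cubic⇒even-order G cubic@(closed , _) = trans
  (sym (parity-sum-odd λ v → cong parity (cubic⇒degree≡3 G cubic v)))
  (even-degree-sum (end G) closed)

-- Deleting and identifying two vertices

Elsewhere : (u v w : Fin n) → Set
Elsewhere u v w = w ≢ u × w ≢ v

elsewhere? : (u v w : Fin n) → Dec (Elsewhere u v w)
elsewhere? u v w = ¬? (w ≟ᶠ u) ×-dec ¬? (w ≟ᶠ v)

ColourableElsewhere : Ends m n → (u v : Fin n) → Set
ColourableElsewhere {m} E u v = Σ[ c ∈ (Fin m → Fin 3) ] (∀ w → Elsewhere u v w → ProperAt E c w)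

delEnd-just : (u : Fin (suc n)) (x : Site (suc n)) (w : Fin n) →
  delEnd u x ≡ just w ⇔ x ≡ just (punchIn u w)
delEnd-just u x w = mk⇔ (remaining x) λ { refl → delEnd-punchIn }
  where
  remaining : ∀ x → delEnd u x ≡ just w → x ≡ just (punchIn u w)
  remaining (just y) eq with y ≟ᶠ u
  ... | no y≢u = cong just (trans (sym (punchIn-punchOut (y≢u ∘ sym)))
    (cong (punchIn u) (just-injective eq)))
  delEnd-punchIn : delEnd u (just (punchIn u w)) ≡ just w
  delEnd-punchIn with punchIn u w ≟ᶠ u
  ... | yes eq = contradiction eq (punchInᵢ≢i u w)
  ... | no _   = cong just (trans (punchOut-cong u refl) (punchOut-punchIn u))

module Delete2 (u v : Fin (2 + k)) (u≢v : u ≢ v) where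

  delete : Site (2 + k) → Site k
  delete x = delEnd (punchOut u≢v) (delEnd u x)

  embed : Fin k → Fin (2 + k)
  embed w = punchIn u (punchIn (punchOut u≢v) w)

  delete-just : ∀ x w → delete x ≡ just w ⇔ x ≡ just (embed w)
  delete-just x w =
    delEnd-just u x (punchIn (punchOut u≢v) w) ⇔-∘ delEnd-just (punchOut u≢v) (delEnd u x) w

  embed-elsewhere : ∀ w → Elsewhere u v (embed w)
  embed-elsewhere w = punchInᵢ≢i u (punchIn (punchOut u≢v) w) , λ embed-w≡v →
    punchInᵢ≢i (punchOut u≢v) w
      (punchIn-injective u _ _ (trans embed-w≡v (sym (punchIn-punchOut u≢v))))

  embed-onto : ∀ w → Elsewhere u v w → ∃ λ w′ → embed w′ ≡ w
  embed-onto w (w≢u , w≢v) = punchOut v′≢w′ ,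
    trans (cong (punchIn u) (punchIn-punchOut v′≢w′)) (punchIn-punchOut u≢w)
    where
    u≢w : u ≢ w
    u≢w = w≢u ∘ sym
    v′≢w′ : punchOut u≢v ≢ punchOut u≢w
    v′≢w′ = w≢v ∘ sym ∘ punchOut-injective u≢v u≢w

colourable-remove2 : ∀ G u v (u≢v : u ≢ v) →
  Colourable (remove2 G u v u≢v) ⇔ ColourableElsewhere (end G) u v
colourable-remove2 (mkGraph 1 m E) zero zero u≢v = contradiction refl u≢v
colourable-remove2 (mkGraph (suc (suc k)) m E) u v u≢v = mk⇔
  (λ (c , proper) → c , λ w elsewhere e i e′ i′ ends-differ at-w at-w′ →
    let w′ , embed-w′≡w = embed-onto w elsewhere
        delete-at-w {x} x≡w =
          from (delete-just x w′) (trans x≡w (cong just (sym embed-w′≡w)))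
    in proper w′ e i e′ i′ ends-differ (delete-at-w at-w) (delete-at-w at-w′))
  (λ (c , proper) → c , λ w e i e′ i′ ends-differ at-w at-w′ →
    proper (embed w) (embed-elsewhere w) e i e′ i′ ends-differ
      (to (delete-just (E e i) w) at-w) (to (delete-just (E e′ i′) w) at-w′))
  where open Delete2 u v u≢v

module Identify (u v : Fin (suc k)) (u≢v : u ≢ v) where

  merge : Fin (suc k) → Fin k
  merge = mergeV u v u≢v

  merge-≢ : ∀ w (v≢w : v ≢ w) → merge w ≡ punchOut v≢w
  merge-≢ w v≢w with w ≟ᶠ v
  ... | yes w≡v = contradiction (sym w≡v) v≢w
  ... | no _    = punchOut-cong v refl

  merge-injective : ∀ x w → Elsewhere u v w → merge x ≡ merge w → x ≡ w
  merge-injective x w (w≢u , w≢v) eq with x ≟ᶠ v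
  ... | no x≢v = punchOut-injective _ (w≢v ∘ sym) (trans eq (merge-≢ w (w≢v ∘ sym)))
  ... | yes _  = contradiction
    (sym (punchOut-injective _ (w≢v ∘ sym) (trans eq (merge-≢ w (w≢v ∘ sym))))) w≢u

  merge-onto : ∀ w′ → w′ ≢ merge u → ∃ λ w → Elsewhere u v w × merge w ≡ w′
  merge-onto w′ w′≢merge-u = punchIn v w′ , (punchIn≢u , punchInᵢ≢i v w′) , merge-punchIn
    where
    merge-punchIn : merge (punchIn v w′) ≡ w′
    merge-punchIn = trans (merge-≢ (punchIn v w′) (punchInᵢ≢i v w′ ∘ sym)) (punchOut-punchIn v)
    punchIn≢u : punchIn v w′ ≢ u
    punchIn≢u eq = w′≢merge-u (trans (sym merge-punchIn) (cong merge eq))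

  map-merge : ∀ x w → Elsewhere u v w → x ≡ just w ⇔ map merge x ≡ just (merge w)
  map-merge x w elsewhere = mk⇔ (cong (map merge)) (map-merge-injective x)
    where
    map-merge-injective : ∀ x → map merge x ≡ just (merge w) → x ≡ just w
    map-merge-injective (just x) eq = cong just (merge-injective x w elsewhere (just-injective eq))

  contract : Ends m (suc k) → Ends m k
  contract E e i = map merge (E e i)

  contract-closed : {E : Ends m (suc k)} → Closed E → Closed (contract E)
  contract-closed closed e i =
    merge (endpoint closed e i) , cong (map merge) (at-endpoint closed e i)

  module _ (E : Ends m (suc k)) (closed : Closed E) (degree≡3 : ∀ w → degree E w ≡ 3) where

    proper⇔klein-contract : ∀ c w → Elsewhere u v w →
      ProperAt E c w ⇔ KleinAt (contract E) c (merge w)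
    proper⇔klein-contract c w elsewhere = mk⇔
      (λ klein b → trans (sym (same-boundary b)) (klein b))
      (λ klein b → trans (same-boundary b) (klein b))
      ⇔-∘ proper⇔klein E c w (degree≡3 w)
      where
      same-boundary : ∀ b →
        boundary E (bit b ∘ c) (just w) ≡ boundary (contract E) (bit b ∘ c) (just (merge w))
      same-boundary b = ℙ-Sum.endSum-relabel E (contract E) (λ e _ → bit b (c e))
        λ e i → map-merge (E e i) w elsewhere

    proper⇒kleinFlow : ∀ c → (∀ w → Elsewhere u v w → ProperAt E c w) →
      ∀ w′ → KleinAt (contract E) c w′
    proper⇒kleinFlow c proper w′ b = at-any (w′ ≟ᶠ merge u)
      where
      at-unmerged : ∀ w′ → w′ ≢ merge u → boundary (contract E) (bit b ∘ c) (just w′) ≡ 0ℙ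
      at-unmerged w′ w′≢merge-u with w , elsewhere , refl ← merge-onto w′ w′≢merge-u =
        to (proper⇔klein-contract c w elsewhere) (proper w elsewhere) b
      at-any : Dec (w′ ≡ merge u) → boundary (contract E) (bit b ∘ c) (just w′) ≡ 0ℙ
      at-any (no w′≢merge-u) = at-unmerged w′ w′≢merge-u
      at-any (yes refl)      =
        boundary-elsewhere (contract E) (contract-closed closed) (bit b ∘ c) (merge u) at-unmerged

    colourableElsewhere⇔kleinFlow : ColourableElsewhere E u v ⇔ KleinFlow (contract E)
    colourableElsewhere⇔kleinFlow = mk⇔
      (λ (c , proper) → c , proper⇒kleinFlow c proper)
      (λ (c , klein) → c , λ w elsewhere →
        from (proper⇔klein-contract c w elsewhere) (klein (merge w)))

colourable-remove2⇔nz4Flow-identify : ∀ G → Cubic G → ∀ u v (u≢v : u ≢ v) →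
  Colourable (remove2 G u v u≢v) ⇔ HasNZ4Flow (identify G u v u≢v)
colourable-remove2⇔nz4Flow-identify G@(mkGraph (suc k) m E) cubic@(closed , _) u v u≢v =
  kleinFlow⇔nz4Flow (identify G u v u≢v) (contract-closed closed) ⇔-∘
    (colourableElsewhere⇔kleinFlow E closed (cubic⇒degree≡3 G cubic) ⇔-∘
      colourable-remove2 G u v u≢v)
  where open Identify u v u≢v

bicritical⇔fourVertexCritical : ∀ G → Cubic G → Bicritical G ⇔ FourVertexCritical G
bicritical⇔fourVertexCritical G cubic = mk⇔
  (λ bicritical u v u≢v →
    to (colourable-remove2⇔nz4Flow-identify G cubic u v u≢v) (bicritical u v u≢v))
  (λ critical u v u≢v →
    from (colourable-remove2⇔nz4Flow-identify G cubic u v u≢v) (critical u v u≢v))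

-- Bicritical snarks are irreducible

InjectiveOn : (Fin n → Bool) → (Fin n → A) → Set
InjectiveOn S φ = ∀ u v → S u ≡ true → S v ≡ true → φ u ≡ φ v → u ≡ v

injectiveOn⇒outside : (S : Fin n → Bool) (φ : Fin n → Fin k) → InjectiveOn S φ → k < n →
  ∃ λ u → S u ≡ false
injectiveOn⇒outside {n} S φ injective k<n =
  let u , Su≢true = ¬∀⟶∃¬ n (λ u → S u ≡ true) (λ u → S u ≟ᵇ true) λ all →
        ℕₚ.<⇒≱ k<n (injective⇒≤ {f = φ} λ {u} {v} → injective u v (all u) (all v))
  in u , ¬-not Su≢true

injectiveOn⇒two-outside : (S : Fin n → Bool) (φ : Fin n → Fin k) → InjectiveOn S φ → suc k < n →
  Σ[ u ∈ Fin n ] Σ[ v ∈ Fin n ] u ≢ v × S u ≡ false × S v ≡ false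
injectiveOn⇒two-outside {suc n} S φ injective (s≤s k<n) =
  let u , Su = injectiveOn⇒outside S φ injective (ℕₚ.m≤n⇒m≤1+n k<n)
      v , Sv = injectiveOn⇒outside (S ∘ punchIn u) (φ ∘ punchIn u)
        (λ x y Sx Sy eq →
          punchIn-injective u x y (injective (punchIn u x) (punchIn u y) Sx Sy eq)) k<n
  in u , punchIn u v , punchInᵢ≢i u v ∘ sym , Su , Sv

even-<⇒suc-< : ∀ {a b} → parity a ≡ 0ℙ → parity b ≡ 0ℙ → a < b → suc a < b
even-<⇒suc-< {a} a-even b-even a<b = ℕₚ.≤∧≢⇒< a<b λ { refl →
  contradiction (trans (sym b-even) (trans (ℙₚ.+-homo-+ 1 a) (cong (1ℙ +ᵖ_) a-even))) λ () }

colourableElsewhere⇒componentColourable : ∀ G F S u v → S u ≡ false → S v ≡ false →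
  ColourableElsewhere (end G) u v → ComponentColourable G F S
colourableElsewhere⇒componentColourable G F S u v Su Sv (c , proper) =
  (λ e _ → c e) , (λ _ _ → refl) , λ w Sw → proper w (inside≢outside Sw Su , inside≢outside Sw Sv)
  where
  inside≢outside : ∀ {w x} → S w ≡ true → S x ≡ false → w ≢ x
  inside≢outside Sw Sx refl = contradiction (trans (sym Sw) Sx) λ ()

bicritical⇒kIrreducible : ∀ G → Cubic G → Bicritical G → ∀ k → KIrreducible k G
bicritical⇒kIrreducible G cubic bicritical k F _ S _ uncolourable
  (H , H-cubic , H<G , φ , _ , φ-injective , _) =
  let u , v , u≢v , Su , Sv = injectiveOn⇒two-outside S φ φ-injective
        (even-<⇒suc-< (cubic⇒even-order H H-cubic) (cubic⇒even-order G cubic) H<G)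
  in uncolourable (colourableElsewhere⇒componentColourable G F S u v Su Sv
       (to (colourable-remove2 G u v u≢v) (bicritical u v u≢v)))

-- Connected components

record Classification {A : Set} (R : A → A → Set) : Set where
  field
    class    : A → A
    sound    : ∀ {x y} → R x y → class x ≡ class y
    complete : ∀ {x y} → class x ≡ class y → EqClosure R x y

Linked : List (A × A) → A → A → Set
Linked L x y = (x , y) ∈ L

-- Union–find: the link a–b gives the members of the class of b the class of a.
classify : DecidableEquality A → (L : List (A × A)) → Classification (Linked L)
classify _≟_ [] = record { class = id ; sound = λ () ; complete = λ { refl → Star.ε } }
classify {A} _≟_ ((a , b) ∷ L) = record { class = class′ ; sound = sound′ ; complete = complete′ }
  where
  open Classification (classify _≟_ L)
  relabel : A → A
  relabel z = if ⌊ z ≟ class b ⌋ then class a else z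
  class′ : A → A
  class′ = relabel ∘ class
  class′-a : class′ a ≡ class a
  class′-a with class a ≟ class b
  ... | yes _ = refl
  ... | no _  = refl
  class′-b : class′ b ≡ class a
  class′-b with class b ≟ class b
  ... | yes _  = refl
  ... | no b≢b = contradiction refl b≢b
  sound′ : ∀ {x y} → Linked ((a , b) ∷ L) x y → class′ x ≡ class′ y
  sound′ (here refl)   = trans class′-a (sym class′-b)
  sound′ (there x-y∈L) = cong relabel (sound x-y∈L)
  same-class⇒connected : ∀ {x y} → class x ≡ class y → EqClosure (Linked ((a , b) ∷ L)) x y
  same-class⇒connected = EqClosure.map there ∘ complete
  connected-to-class′ : ∀ x → ∃ λ z → class′ x ≡ class z × EqClosure (Linked ((a , b) ∷ L)) x z
  connected-to-class′ x with class x ≟ class b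
  ... | yes x≡b = a , refl , same-class⇒connected x≡b ◅◅ (bwd (here refl) ◅ Star.ε)
  ... | no _    = x , refl , Star.ε
  complete′ : ∀ {x y} → class′ x ≡ class′ y → EqClosure (Linked ((a , b) ∷ L)) x y
  complete′ {x} {y} eq =
    let x′ , class′-x , x∼x′ = connected-to-class′ x
        y′ , class′-y , y∼y′ = connected-to-class′ y
        x′∼y′ = same-class⇒connected (trans (sym class′-x) (trans eq class′-y))
    in x∼x′ ◅◅ (x′∼y′ ◅◅ EqClosure.symmetric _ y∼y′)

⌊⌋≡true : (a? : Dec A) → ⌊ a? ⌋ ≡ true ⇔ A
⌊⌋≡true a? = mk⇔ (toWitness ∘ from T-≡) (to T-≡ ∘ fromWitness)

⌊⌋≡false : (a? : Dec A) → ⌊ a? ⌋ ≡ false ⇔ (¬ A)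
⌊⌋≡false a? = mk⇔ (toWitnessFalse ∘ from T-not-≡) (to T-not-≡ ∘ fromWitnessFalse)

module Components (G : Graph) (closed : IsGraph G) (F : Fin (nE G) → Bool) where

  kept? : Decidable λ e → F e ≡ false
  kept? e = F e ≟ᵇ false

  kept : List (Fin (nE G))
  kept = filter kept? (allFin (nE G))

  ∈-kept : ∀ e → e ∈ kept ⇔ F e ≡ false
  ∈-kept e = mk⇔ (proj₂ ∘ ∈-filter⁻ kept? {xs = allFin (nE G)}) (∈-filter⁺ kept? (∈-allFin e))

  links : List (Fin (nV G) × Fin (nV G))
  links = List.map (λ e → endpoint closed e 0F , endpoint closed e 1F) kept

  linked : ∀ {x y} → Linked links x y ⇔
    (∃ λ e → F e ≡ false × end G e 0F ≡ just x × end G e 1F ≡ just y)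
  linked = mk⇔
    (λ x-y∈ → case ∈-map⁻ _ x-y∈ of λ { (e , e∈kept , refl) →
      e , to (∈-kept e) e∈kept , at-endpoint closed e 0F , at-endpoint closed e 1F })
    (λ (e , e-kept , at-x , at-y) →
      subst (_∈ links) (cong₂ _,_ (endpoint-unique closed at-x) (endpoint-unique closed at-y))
        (∈-map⁺ _ (from (∈-kept e) e-kept)))

  open Classification (classify _≟ᶠ_ links) public

  component : Fin (nV G) → Fin (nV G) → Bool
  component ℓ y = ⌊ class y ≟ᶠ ℓ ⌋

  ∈-component : ∀ ℓ y → component ℓ y ≡ true ⇔ class y ≡ ℓ
  ∈-component ℓ y = ⌊⌋≡true (class y ≟ᶠ ℓ)

  component-isComponent : ∀ w → Component G F (component (class w))
  component-isComponent w =
    (w , from (∈-component (class w) w) refl) ,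
    (λ e x y e-kept at-x at-y →
      cong (λ ℓ → ⌊ ℓ ≟ᶠ class w ⌋) (sound (from linked (e , e-kept , at-x , at-y)))) ,
    λ x y Sx Sy → Star.map adjacent
      (complete (trans (to (∈-component _ x) Sx) (sym (to (∈-component _ y) Sy))))
    where
    adjacent : ∀ {x y} → SymClosure (Linked links) x y → AdjOff G F (component (class w)) x y
    adjacent (fwd x-y∈) = let e , e-kept , at-x , at-y = to linked x-y∈ in
      e , e-kept , inj₁ (at-x , at-y)
    adjacent (bwd y-x∈) = let e , e-kept , at-y , at-x = to linked y-x∈ in
      e , e-kept , inj₂ (at-y , at-x)

-- Prescribed degrees

attach : (Fin m → Fin 2 → Fin n) → Ends m n
attach P e i = just (P e i)

split-positive : ∀ {s} (r : Fin n → ℕ) → ℕ-Sum.sum r ≡ suc s →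
  Σ[ a ∈ Fin n ] Σ[ r′ ∈ (Fin n → ℕ) ]
    ℕ-Sum.sum r′ ≡ s × (∀ v → r v ≡ ℕ-Sum.mass (just a) 1 (just v) + r′ v)
split-positive {suc n} r sum≡1+s with r zero in r-zero
... | suc k = zero , k ∷ᵛ (r ∘ suc) , ℕₚ.suc-injective sum≡1+s ,
  λ { zero → r-zero ; (suc v) → refl }
... | zero  with a , r′ , sum-r′ , split ← split-positive (r ∘ suc) sum≡1+s
  = suc a , 0 ∷ᵛ r′ , sum-r′ , λ where
      zero    → r-zero
      (suc v) → trans (split v) (cong (_+ r′ v)
        (ℕ-Sum.mass-cong-⇔ 1 (mk⇔ (cong (map suc)) λ { refl → refl })))

-- Loops and parallel edges are allowed, so the parity of the degree sum is the only obstruction.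
realise-degrees : ∀ t (r : Fin n → ℕ) → ℕ-Sum.sum r ≡ t + t →
  Σ[ P ∈ (Fin t → Fin 2 → Fin n) ] (∀ v → degree (attach P) v ≡ r v)
realise-degrees zero r sum≡0 =
  (λ ()) , λ v → sym (ℕₚ.n≤0⇒n≡0 (subst (r v ≤_) sum≡0 (≤-sum r v)))
realise-degrees {n} (suc t) r sum≡2+2t
  with a , r₁ , sum-r₁ , split-r ← split-positive r sum≡2+2t
  with b , r₂ , sum-r₂ , split-r₁ ← split-positive r₁ (trans sum-r₁ (ℕₚ.+-suc t t))
  with P , P-degree ← realise-degrees t r₂ sum-r₂
  = (a ∷ᵛ b ∷ᵛ λ ()) ∷ᵛ P , λ v → begin
      (at v a + (at v b + 0)) + degree (attach P) v
        ≡⟨ cong₂ (λ i j → (at v a + i) + j) (ℕₚ.+-identityʳ (at v b)) (P-degree v) ⟩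
      (at v a + at v b) + r₂ v   ≡⟨ ℕₚ.+-assoc (at v a) (at v b) (r₂ v) ⟩
      at v a + (at v b + r₂ v)   ≡⟨ cong (at v a +_) (split-r₁ v) ⟨
      at v a + r₁ v              ≡⟨ split-r v ⟨
      r v                        ∎
  where
  open ≡-Reasoning
  at : Fin n → Fin n → ℕ
  at v a = ℕ-Sum.mass (just a) 1 (just v)

deficit : Ends m n → (Fin n → ℕ) → Fin n → ℕ
deficit E d v = d v ∸ degree E v

even-deficit-sum : (E : Ends m n) → Closed E → (d : Fin n → ℕ) → parity (ℕ-Sum.sum d) ≡ 0ℙ →
  (∀ v → degree E v ≤ d v) → parity (ℕ-Sum.sum (deficit E d)) ≡ 0ℙ
even-deficit-sum E closed d d-even degree≤d = begin
  parity (ℕ-Sum.sum (deficit E d))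
    ≡⟨ cong (_+ᵖ parity (ℕ-Sum.sum (deficit E d))) (even-degree-sum E closed) ⟨
  parity (ℕ-Sum.sum (degree E)) +ᵖ parity (ℕ-Sum.sum (deficit E d))
    ≡⟨ ℙₚ.+-homo-+ (ℕ-Sum.sum (degree E)) _ ⟨
  parity (ℕ-Sum.sum (degree E) + ℕ-Sum.sum (deficit E d))
    ≡⟨ cong parity (ℕ-Sum.∑-distrib-+ (degree E) (deficit E d)) ⟨
  parity (ℕ-Sum.sum λ v → degree E v + deficit E d v)
    ≡⟨ cong parity (ℕ-Sum.sum-cong-≗ λ v → ℕₚ.m+[n∸m]≡n (degree≤d v)) ⟩
  parity (ℕ-Sum.sum d)
    ≡⟨ d-even ⟩
  0ℙ ∎
  where open ≡-Reasoning

complete-degrees : (P : Fin m → Fin 2 → Fin n) (d : Fin n → ℕ) → parity (ℕ-Sum.sum d) ≡ 0ℙ →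
  (∀ v → degree (attach P) v ≤ d v) →
  Σ[ t ∈ ℕ ] Σ[ Q ∈ (Fin t → Fin 2 → Fin n) ] (∀ v → degree (attach (P ++ Q)) v ≡ d v)
complete-degrees P d d-even degree≤d =
  let t , sum≡2t = even⇒double (ℕ-Sum.sum (deficit (attach P) d))
        (even-deficit-sum (attach P) (λ e i → P e i , refl) d d-even degree≤d)
      Q , Q-degree = realise-degrees t (deficit (attach P) d) sum≡2t
  in t , Q , λ v → begin
    degree (attach (P ++ Q)) v
      ≡⟨ ℕ-Sum.sum-++ (λ ends → ℕ-Sum.sum λ i → ℕ-Sum.mass (just (ends i)) 1 (just v)) P Q ⟩
    degree (attach P) v + degree (attach Q) v
      ≡⟨ cong (degree (attach P) v +_) (Q-degree v) ⟩
    degree (attach P) v + deficit (attach P) d v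
      ≡⟨ ℕₚ.m+[n∸m]≡n (degree≤d v) ⟩
    d v ∎
  where open ≡-Reasoning

cubic⇒edge : ∀ G → Cubic G → Fin (nV G) → Fin (nE G)
cubic⇒edge (mkGraph n zero E)    (_ , deg≡3) v = contradiction (deg≡3 v) λ ()
cubic⇒edge (mkGraph n (suc m) E) _           _ = zero

-- Irreducible snarks are bicritical

module RemoveTwo (E : Ends m (2 + k)) (cubic : Cubic (mkGraph (2 + k) m E))
  (u v : Fin (2 + k)) (u≢v : u ≢ v) where

  open Delete2 u v u≢v

  G : Graph
  G = mkGraph (2 + k) m E

  vertexOf : Fin m → Fin 2 → Fin (2 + k)
  vertexOf = endpoint (proj₁ cubic)

  at-vertexOf : ∀ e i → E e i ≡ just (vertexOf e i)
  at-vertexOf = at-endpoint (proj₁ cubic)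

  touches? : ∀ e → Dec (∃ λ i → ¬ Elsewhere u v (vertexOf e i))
  touches? e = any? λ i → ¬? (elsewhere? u v (vertexOf e i))

  touching : Fin m → Bool
  touching e = ⌊ touches? e ⌋

  not-touching : ∀ e → touching e ≡ false ⇔ (∀ i → Elsewhere u v (vertexOf e i))
  not-touching e = mk⇔
    (λ e-kept i → decidable-stable (elsewhere? u v (vertexOf e i)) λ ¬elsewhere →
      to (⌊⌋≡false (touches? e)) e-kept (i , ¬elsewhere))
    (λ elsewhere → from (⌊⌋≡false (touches? e)) λ (i , ¬elsewhere) → ¬elsewhere (elsewhere i))

  count-touching<7 : count touching < 7
  count-touching<7 = s≤s (begin
    count touching
      ≡⟨ sumℕ≡sum (λ e → if touching e then 1 else 0) ⟩
    ℕ-Sum.sum (λ e → if touching e then 1 else 0)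
      ≤⟨ sum-mono touching≤incidences ⟩
    ℕ-Sum.sum (λ e → incidences u e + incidences v e)
      ≡⟨ ℕ-Sum.∑-distrib-+ (incidences u) (incidences v) ⟩
    degree E u + degree E v
      ≡⟨ cong₂ _+_ (cubic⇒degree≡3 G cubic u) (cubic⇒degree≡3 G cubic v) ⟩
    6 ∎)
    where
    open ℕₚ.≤-Reasoning
    incidences : Fin (2 + k) → Fin m → ℕ
    incidences w = ℕ-Sum.edgeSum E (λ _ _ → 1) (just w)
    1≤incidences : ∀ e i {w} → vertexOf e i ≡ w → 1 ≤ incidences w e
    1≤incidences e i refl = begin
      1
        ≡⟨ ℕ-Sum.mass-≡ 1 (at-vertexOf e i) ⟨
      ℕ-Sum.mass (E e i) 1 (just (vertexOf e i))
        ≤⟨ ≤-sum (λ i′ → ℕ-Sum.mass (E e i′) 1 (just (vertexOf e i))) i ⟩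
      incidences (vertexOf e i) e ∎
    touching≤incidences : ∀ e → (if touching e then 1 else 0) ≤ incidences u e + incidences v e
    touching≤incidences e with touches? e
    ... | no _ = z≤n
    ... | yes (i , ¬elsewhere) with vertexOf e i ≟ᶠ u | vertexOf e i ≟ᶠ v
    ...   | yes at-u | _        = ℕₚ.≤-trans (1≤incidences e i at-u) (ℕₚ.m≤m+n _ _)
    ...   | no _     | yes at-v = ℕₚ.≤-trans (1≤incidences e i at-v) (ℕₚ.m≤n+m _ (incidences u e))
    ...   | no ¬at-u | no ¬at-v = contradiction (¬at-u , ¬at-v) ¬elsewhere

  open Components G (proj₁ cubic) touching

  linked⇒elsewhere : ∀ {x y} → Linked links x y → Elsewhere u v x × Elsewhere u v y
  linked⇒elsewhere x-y∈ =
    let e , e-kept , at-x , at-y = to linked x-y∈ in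
    subst (Elsewhere u v) (endpoint-unique (proj₁ cubic) at-x) (to (not-touching e) e-kept 0F) ,
    subst (Elsewhere u v) (endpoint-unique (proj₁ cubic) at-y) (to (not-touching e) e-kept 1F)

  isolated : ∀ {x y} → ¬ Elsewhere u v x → EqClosure (Linked links) x y → x ≡ y
  isolated _          Star.ε         = refl
  isolated ¬elsewhere (fwd x-z∈ ◅ _) = contradiction (proj₁ (linked⇒elsewhere x-z∈)) ¬elsewhere
  isolated ¬elsewhere (bwd z-x∈ ◅ _) = contradiction (proj₂ (linked⇒elsewhere z-x∈)) ¬elsewhere

  same-class⇒elsewhere : ∀ {w y} → Elsewhere u v w → class y ≡ class w → Elsewhere u v y
  same-class⇒elsewhere {w} {y} elsewhere same = decidable-stable (elsewhere? u v y) λ ¬elsewhere →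
    ¬elsewhere (subst (Elsewhere u v) (sym (isolated ¬elsewhere (complete same))) elsewhere)

  -- Junk values: w₀ for the deleted vertices u and v, and an edge of H for the touching edges.
  module Collapse (w₀ : Fin k) where

    collapse : Fin (2 + k) → Fin k
    collapse y = fromMaybe w₀ (delete (just y))

    collapse-embed : ∀ w → collapse (embed w) ≡ w
    collapse-embed w = cong (fromMaybe w₀) (from (delete-just (just (embed w)) w) refl)

    embed-collapse : ∀ y → Elsewhere u v y → embed (collapse y) ≡ y
    embed-collapse y elsewhere with w , refl ← embed-onto y elsewhere =
      cong embed (collapse-embed w)

    keptEnds : Fin (length kept) → Fin 2 → Fin k
    keptEnds j i = collapse (vertexOf (lookup kept j) i)

    keptEnds-at : ∀ j i w → attach keptEnds j i ≡ just w ⇔ E (lookup kept j) i ≡ just (embed w)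
    keptEnds-at j i w = mk⇔
      (λ at-w → trans (at-vertexOf e i) (cong just (begin
        vertexOf e i                     ≡⟨ embed-collapse (vertexOf e i) elsewhere ⟨
        embed (collapse (vertexOf e i))  ≡⟨ cong embed (just-injective at-w) ⟩
        embed w                          ∎)))
      (λ at-embed-w → cong just
        (trans (cong collapse (endpoint-unique (proj₁ cubic) at-embed-w)) (collapse-embed w)))
      where
      open ≡-Reasoning
      e : Fin m
      e = lookup kept j
      elsewhere : Elsewhere u v (vertexOf e i)
      elsewhere = to (not-touching e) (to (∈-kept e) (∈-lookup j)) i

    keptEnds-degree≤3 : ∀ w → degree (attach keptEnds) w ≤ 3
    keptEnds-degree≤3 w = begin
      degree (attach keptEnds) w
        ≡⟨ ℕ-Sum.endSum-relabel (attach keptEnds) (E ∘ lookup kept) (λ _ _ → 1)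
             (λ j i → keptEnds-at j i w) ⟩
      ℕ-Sum.sumOver kept (ℕ-Sum.edgeSum E (λ _ _ → 1) (just (embed w)))
        ≤⟨ sumOver-filter-≤ kept? _ ⟩
      degree E (embed w)
        ≡⟨ cubic⇒degree≡3 G cubic (embed w) ⟩
      3 ∎
      where open ℕₚ.≤-Reasoning

    module Completion (t : ℕ) (newEnds : Fin t → Fin 2 → Fin k)
      (degree≡3 : ∀ w → degree (attach (keptEnds ++ newEnds)) w ≡ 3) where

      H : Graph
      H = mkGraph k (length kept + t) (attach (keptEnds ++ newEnds))

      H-cubic : Cubic H
      H-cubic = (λ e i → (keptEnds ++ newEnds) e i , refl) ,
        λ w → trans (deg≡degree H w) (degree≡3 w)

      place : ∀ e → Dec (touching e ≡ false) → Fin (length kept + t)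
      place e (yes e-kept) = index (from (∈-kept e) e-kept) ↑ˡ t
      place e (no _)       = cubic⇒edge H H-cubic w₀

      place-kept : ∀ e (e-kept? : Dec (touching e ≡ false)) → touching e ≡ false →
        ∃ λ j → lookup kept j ≡ e × place e e-kept? ≡ j ↑ˡ t
      place-kept e (yes e-kept) _      = _ , sym (lookup-index (from (∈-kept e) e-kept)) , refl
      place-kept e (no ¬e-kept) e-kept = contradiction e-kept ¬e-kept

      ψ : Fin m → Fin (length kept + t)
      ψ e = place e (kept? e)

      ψ-injective : ∀ e e′ → touching e ≡ false → touching e′ ≡ false → ψ e ≡ ψ e′ → e ≡ e′
      ψ-injective e e′ e-kept e′-kept ψe≡ψe′ =
        let j , lookup-j≡e , ψe = place-kept e (kept? e) e-kept
            j′ , lookup-j′≡e′ , ψe′ = place-kept e′ (kept? e′) e′-kept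
        in begin
          e
            ≡⟨ lookup-j≡e ⟨
          lookup kept j
            ≡⟨ cong (lookup kept) (↑ˡ-injective t j j′ (trans (sym ψe) (trans ψe≡ψe′ ψe′))) ⟩
          lookup kept j′
            ≡⟨ lookup-j′≡e′ ⟩
          e′ ∎
        where open ≡-Reasoning

      ψ-ends : ∀ e → touching e ≡ false → ∀ i → end H (ψ e) i ≡ map collapse (E e i)
      ψ-ends e e-kept i = let j , lookup-j≡e , ψe = place-kept e (kept? e) e-kept in begin
        just ((keptEnds ++ newEnds) (ψ e) i)
          ≡⟨ cong (λ e → just ((keptEnds ++ newEnds) e i)) ψe ⟩
        just ((keptEnds ++ newEnds) (j ↑ˡ t) i)
          ≡⟨ cong (λ ends → just (ends i)) (lookup-++ˡ keptEnds newEnds j) ⟩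
        just (collapse (vertexOf (lookup kept j) i))
          ≡⟨ cong (λ e → just (collapse (vertexOf e i))) lookup-j≡e ⟩
        just (collapse (vertexOf e i))
          ≡⟨ cong (map collapse) (at-vertexOf e i) ⟨
        map collapse (E e i) ∎
        where open ≡-Reasoning

      completed : ∀ S → (∀ y → S y ≡ true → Elsewhere u v y) → CompletableToSmaller G touching S
      completed S S-elsewhere =
        H , H-cubic , s≤s (ℕₚ.n≤1+n k) , collapse , ψ ,
        (λ x y Sx Sy collapse-x≡collapse-y → begin
          x                   ≡⟨ embed-collapse x (S-elsewhere x Sx) ⟨
          embed (collapse x)  ≡⟨ cong embed collapse-x≡collapse-y ⟩
          embed (collapse y)  ≡⟨ embed-collapse y (S-elsewhere y Sy) ⟩
          y                   ∎) ,
        (λ e e′ (e-kept , _) (e′-kept , _) → ψ-injective e e′ e-kept e′-kept) ,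
        λ e (e-kept , _) → inj₁ (ψ-ends e e-kept)
        where open ≡-Reasoning

    completable : ∀ S → (∀ y → S y ≡ true → Elsewhere u v y) → CompletableToSmaller G touching S
    completable =
      let t , newEnds , degree≡3 = complete-degrees keptEnds (const 3)
            (trans (parity-sum-odd {k} λ _ → refl) (cubic⇒even-order G cubic)) keptEnds-degree≤3
      in Completion.completed t newEnds degree≡3

  ClassColouring : Fin (2 + k) → Set
  ClassColouring ℓ = Σ[ c ∈ (Fin m → Fin 2 → Fin 3) ]
    (∀ e → touching e ≡ false → c e 0F ≡ c e 1F) ×
    (∀ w → class w ≡ ℓ → Elsewhere u v w → ∀ e i e′ i′ → (e , i) ≢ (e′ , i′) →
      E e i ≡ just w → E e′ i′ ≡ just w → c e i ≢ c e′ i′)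

  irreducible⇒classColouring : KIrreducible 7 G → ∀ ℓ → ¬ ¬ ClassColouring ℓ
  irreducible⇒classColouring irreducible ℓ uncolourable
    with any? (λ w → (class w ≟ᶠ ℓ) ×-dec elsewhere? u v w)
  ... | no none = uncolourable ((λ _ _ → 0F) , (λ _ _ → refl) ,
    λ w in-class elsewhere → contradiction (w , in-class , elsewhere) none)
  ... | yes (w , refl , elsewhere) =
    irreducible touching count-touching<7 (component ℓ) (component-isComponent w)
      (λ (c , consistent , proper) → uncolourable (c , consistent ,
        λ w′ in-class _ → proper w′ (from (∈-component ℓ w′) in-class)))
      (Collapse.completable (proj₁ (embed-onto w elsewhere)) (component ℓ)
        λ y y∈ → same-class⇒elsewhere elsewhere (to (∈-component ℓ y) y∈))

  glue : (∀ ℓ → ClassColouring ℓ) → ColourableElsewhere E u v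
  glue colouring = c , λ w elsewhere e i e′ i′ ends-differ at-w at-w′ same →
    proj₂ (proj₂ (colouring (class w))) w refl elsewhere e i e′ i′ ends-differ at-w at-w′
      (trans (sym (c-at elsewhere e i at-w)) (trans same (c-at elsewhere e′ i′ at-w′)))
    where
    half : Fin m → Fin 2 → Fin 3
    half e i = proj₁ (colouring (class (vertexOf e i))) e i
    halves-agree : ∀ e → (∀ i → Elsewhere u v (vertexOf e i)) → half e 0F ≡ half e 1F
    halves-agree e elsewhere = trans
      (cong (λ ℓ → proj₁ (colouring ℓ) e 0F)
        (sound (from linked (e , e-kept , at-vertexOf e 0F , at-vertexOf e 1F))))
      (proj₁ (proj₂ (colouring (class (vertexOf e 1F)))) e e-kept)
      where
      e-kept : touching e ≡ false
      e-kept = from (not-touching e) elsewhere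
    c : Fin m → Fin 3
    c e = if ⌊ elsewhere? u v (vertexOf e 0F) ⌋ then half e 0F else half e 1F
    c-half : ∀ e i → Elsewhere u v (vertexOf e i) → c e ≡ half e i
    c-half e i elsewhere with elsewhere? u v (vertexOf e 0F)
    c-half e 0F elsewhere | yes _           = refl
    c-half e 0F elsewhere | no ¬elsewhere   = contradiction elsewhere ¬elsewhere
    c-half e 1F elsewhere | no _            = refl
    c-half e 1F elsewhere | yes 0-elsewhere = halves-agree e λ { 0F → 0-elsewhere ; 1F → elsewhere }
    c-at : ∀ {w} → Elsewhere u v w → ∀ e i → E e i ≡ just w → c e ≡ proj₁ (colouring (class w)) e i
    c-at elsewhere e i at-w with refl ← endpoint-unique (proj₁ cubic) at-w = c-half e i elsewhere

colourable? : ∀ G → Dec (Colourable G)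
colourable? G = any-map?
  (λ c≗d proper v e i e′ i′ ends-differ at-v at-v′ same →
    proper v e i e′ i′ ends-differ at-v at-v′ (trans (c≗d e) (trans same (sym (c≗d e′)))))
  (λ c → all? λ v → all? λ e → all? λ i → all? λ e′ → all? λ i′ →
    ¬? (×-≡-dec _≟ᶠ_ _≟ᶠ_ (e , i) (e′ , i′)) →-dec ((end G e i ≟ᵐ just v) →-dec
      ((end G e′ i′ ≟ᵐ just v) →-dec ¬? (c e ≟ᶠ c e′))))

-- Irreducibility only refutes that a component is uncolourable; the double negation is harmless
-- because colourability is decidable.
7-irreducible⇒bicritical : ∀ G → Cubic G → KIrreducible 7 G → Bicritical G
7-irreducible⇒bicritical (mkGraph 1 m E) _ _ zero zero u≢v = contradiction refl u≢v
7-irreducible⇒bicritical G@(mkGraph (suc (suc k)) m E) cubic irreducible u v u≢v =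
  decidable-stable (colourable? (remove2 G u v u≢v))
    (¬¬-map (from (colourable-remove2 G u v u≢v) ∘ glue)
      (sequence (RawMonad.rawApplicative ¬¬-Monad) (irreducible⇒classColouring irreducible)))
  where open RemoveTwo E cubic u v u≢v using (irreducible⇒classColouring; glue)

theorem5 : (G : Graph) → Snark G →
    (Bicritical G ⇔ FourVertexCritical G) ×
    (Bicritical G ⇔ KIrreducible 7 G) ×
    (Bicritical G ⇔ Irreducible G)
theorem5 G (cubic , _) =
  bicritical⇔fourVertexCritical G cubic ,
  mk⇔ (λ bicritical → bicritical⇒kIrreducible G cubic bicritical 7)
      (7-irreducible⇒bicritical G cubic) ,
  mk⇔ (λ bicritical k _ → bicritical⇒kIrreducible G cubic bicritical k)
      (λ irreducible → 7-irreducible⇒bicritical G cubic (irreducible 7 (s≤s z≤n)))
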